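{- Let $n\ge 3$ be an odd integer and $G=\langle\sigma,\tau:\sigma^n=\tau^2=1,\ \tau\sigma\tau^{ -1}=\sigma^{ -1}\rangle\simeq D_n$. Then there is an isomorphism of $G$-lattices $\widetilde{M}_+\oplus\widetilde{M}_-\simeq\mathbb{Z}[G]\oplus\mathbb{Z}[G/\langle\sigma\rangle]$.
   Context: $D_n$ is the dihedral group of order $2n$. A $G$-lattice is a finitely generated $\mathbb{Z}[G]$-module that is torsion-free as an abelian group; for a subgroup $S\le G$, $\mathbb{Z}[G/S]$ is the permutation lattice on the left cosets of $S$. The $G$-lattice $\widetilde{M}_+$ of rank $n+1$ is the free abelian group with basis $w_0,\ldots,w_{n-1},w$ (indices modulo $n$) and action $\sigma\cdot w_i=w_{i+1}$, $\tau\cdot w_i=w_{ -i}$, $\sigma\cdot w=w$, $\tau\cdot w=-w+\sum_{0\le i\le n-1}w_i$. The $G$-lattice $\widetilde{M}_-$ of rank $n+1$ is the free abelian group with basis $w_0,\ldots,w_{n-1},w'$ (indices modulo $n$) and action $\sigma\cdot w_i=w_{i+1}$, $\tau\cdot w_i=-w_{ -i}$, $\sigma\cdot w'=w'$, $\tau\cdot w'=w'-\sum_{0\le i\le n-1}w_i$. -}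

module Defs where

open import Algebra.Bundles using (Group; AbelianGroup)
import Algebra.Construct.DirectProduct as DirectProduct
import Algebra.Definitions.RawMonoid as RawMonoidDefs
open import Algebra.Morphism.Structures using (module GroupMorphisms)
import Algebra.Properties.AbelianGroup as AbelianGroupProperties
import Algebra.Properties.CommutativeMonoid.Sum as Sum
import Algebra.Properties.Group as GroupProperties
open import Data.Bool.Base using (Bool; true; false; _xor_; if_then_else_)
open import Data.Bool.Properties using (xor-assoc; xor-identityʳ; xor-same)
open import Data.Empty using (⊥-elim)
open import Data.Fin.Base using (Fin; zero; suc; toℕ)
open import Data.Fin.Permutation using (Permutation; permutation)
open import Data.Fin.Properties using (toℕ-injective; toℕ-fromℕ<; toℕ<n; *↔×; 2↔Bool)
  renaming (_≟_ to _≟ᶠ_)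
open import Data.Integer.Base as ℤ using (ℤ; 0ℤ; 1ℤ; +_; -[1+_])
import Data.Integer.Properties as ℤ
open import Data.List.Base using (List; map; tabulate; _++_)
open import Data.List.Membership.Propositional using (_∈_)
open import Data.List.Membership.Propositional.Properties using (∈-map⁺; ∈-++⁺ˡ; ∈-++⁺ʳ; ∈-tabulate⁺)
open import Data.Nat.Base as ℕ using (ℕ; zero; suc; NonZero; _%_; _/_; _∸_)
open import Data.Nat.DivMod using (_mod_; m%n<n; m<n⇒m%n≡m; %-distribˡ-+; n%n≡0; m≡m%n+[m/n]*n)
open import Data.Nat.GeneralisedArithmetic using (fold)
import Data.Nat.Properties as ℕ
open import Data.Product.Base using (_×_; _,_; proj₁; proj₂; ∃; ∃₂; ∃-syntax)
open import Function.Base using (_∘_; id)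
open import Function.Bundles using (Func; Inverse; _⟨$⟩_; mk↔ₛ′)
open import Function.Construct.Composition using (_↔-∘_)
open import Function.Construct.Identity using (↔-id)
open import Data.Product.Function.NonDependent.Propositional using (_×-↔_)
open import Level using (0ℓ)
open import Relation.Binary.Bundles using (Setoid)
open import Relation.Binary.PropositionalEquality as ≡ using (_≡_; refl; cong; cong₂)
import Relation.Binary.Reasoning.Setoid as SetoidReasoning
open import Relation.Nullary.Decidable.Core using (does; yes; no)
open import Relation.Unary using (Pred)

------------------------------------------------------------------------
-- Subgroups

-- The smallest subgroup containing all x with P x.
data Generated (G : Group 0ℓ 0ℓ) (P : Pred (Group.Carrier G) 0ℓ) : Pred (Group.Carrier G) 0ℓ where
  gen  : ∀ {x} → P x → Generated G P x
  resp : ∀ {x y} → (Group._≈_ G x y) → Generated G P x → Generated G P y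
  unit : Generated G P (Group.ε G)
  mul  : ∀ {x y} → Generated G P x → Generated G P y → Generated G P (Group._∙_ G x y)
  inv  : ∀ {x} → Generated G P x → Generated G P (Group._⁻¹ G x)

record Subgroup (G : Group 0ℓ 0ℓ) : Set₁ where
  open Group G
  field
    Member    : Pred Carrier 0ℓ
    ≈-closed  : ∀ {x y} → x ≈ y → Member x → Member y
    ε-closed  : Member ε
    ∙-closed  : ∀ {x y} → Member x → Member y → Member (x ∙ y)
    ⁻¹-closed : ∀ {x} → Member x → Member (x ⁻¹)

cyclic : (G : Group 0ℓ 0ℓ) → Group.Carrier G → Subgroup G
cyclic G g = record
  { Member    = Generated G (_≡ g)
  ; ≈-closed  = resp
  ; ε-closed  = unit
  ; ∙-closed  = mul
  ; ⁻¹-closed = inv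
  }

------------------------------------------------------------------------
-- G-lattices

record GModule (G : Group 0ℓ 0ℓ) : Set₁ where
  infixr 9 _·_
  private module G = Group G
  field
    abelianGroup : AbelianGroup 0ℓ 0ℓ
  open AbelianGroup abelianGroup public
    renaming (_∙_ to _+_; ε to 0#; _⁻¹ to -_)
  field
    _·_         : G.Carrier → Carrier → Carrier
    ·-cong      : ∀ {g h x y} → g G.≈ h → x ≈ y → g · x ≈ h · y
    ·-distrib-+ : ∀ g x y → g · (x + y) ≈ g · x + g · y
    ·-assoc     : ∀ g h x → (g G.∙ h) · x ≈ g · (h · x)
    ·-identity  : ∀ x → G.ε · x ≈ x

-- The ℤ[G]-submodule generated by gs is the additive subgroup generated by the
-- translates of the elements of gs.
IsFinitelyGenerated : {G : Group 0ℓ 0ℓ} → GModule G → Set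
IsFinitelyGenerated {G} M =
  ∃[ gs ] ∀ x → Generated group (λ y → ∃₂ λ g m → m ∈ gs × y ≈ g · m) x
  where open GModule M

IsTorsionFree : {G : Group 0ℓ 0ℓ} → GModule G → Set
IsTorsionFree M = ∀ k .{{_ : NonZero k}} x → k ⋆ x ≈ 0# → x ≈ 0#
  where
  open GModule M
  open RawMonoidDefs rawMonoid renaming (_×_ to _⋆_)

record GLattice (G : Group 0ℓ 0ℓ) : Set₁ where
  field
    gModule             : GModule G
    isFinitelyGenerated : IsFinitelyGenerated gModule
    isTorsionFree       : IsTorsionFree gModule
  open GModule gModule public

infix 4 _≅_
record _≅_ {G : Group 0ℓ 0ℓ} (L M : GLattice G) : Set where
  private
    module G = Group G
    module L = GLattice L
    module M = GLattice M
  open GroupMorphisms L.rawGroup M.rawGroup using (IsGroupIsomorphism)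
  field
    ⟦_⟧                : L.Carrier → M.Carrier
    isGroupIsomorphism : IsGroupIsomorphism ⟦_⟧
    equivariant        : ∀ g x → ⟦ g L.· x ⟧ M.≈ g M.· ⟦ x ⟧

infixr 6 _⊕_
_⊕_ : {G : Group 0ℓ 0ℓ} → GLattice G → GLattice G → GLattice G
_⊕_ {G} L M = record
  { gModule = LM
  ; isFinitelyGenerated = gens , λ { (x , y) → resp (L.identityʳ x , M.identityˡ y)
              (mul (inˡ (proj₂ L.isFinitelyGenerated x)) (inʳ (proj₂ M.isFinitelyGenerated y))) }
  ; isTorsionFree = λ { k (x , y) kxy≈0 →
        L.isTorsionFree k x (L.trans (L.sym (⋆-proj₁ k x y)) (proj₁ kxy≈0))
      , M.isTorsionFree k y (M.trans (M.sym (⋆-proj₂ k x y)) (proj₂ kxy≈0)) }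
  }
  where
  module G = Group G
  module L = GLattice L
  module M = GLattice M

  LM : GModule G
  LM = record
    { abelianGroup = DirectProduct.abelianGroup L.abelianGroup M.abelianGroup
    ; _·_          = λ { g (x , y) → g L.· x , g M.· y }
    ; ·-cong       = λ { g≈h (p , q) → L.·-cong g≈h p , M.·-cong g≈h q }
    ; ·-distrib-+  = λ { g (x , y) (x′ , y′) → L.·-distrib-+ g x x′ , M.·-distrib-+ g y y′ }
    ; ·-assoc      = λ { g h (x , y) → L.·-assoc g h x , M.·-assoc g h y }
    ; ·-identity   = λ { (x , y) → L.·-identity x , M.·-identity y }
    }
  module LM = GModule LM

  ·-zeroˡ : ∀ g → L.0# L.≈ g L.· L.0#
  ·-zeroˡ g = L.sym (GroupProperties.identityʳ-unique L.group (g L.· L.0#) (g L.· L.0#)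
    (L.trans (L.sym (L.·-distrib-+ g _ _)) (L.·-cong G.refl (L.identityˡ _))))

  ·-zeroʳ : ∀ g → M.0# M.≈ g M.· M.0#
  ·-zeroʳ g = M.sym (GroupProperties.identityʳ-unique M.group (g M.· M.0#) (g M.· M.0#)
    (M.trans (M.sym (M.·-distrib-+ g _ _)) (M.·-cong G.refl (M.identityˡ _))))

  gens : List LM.Carrier
  gens = map (_, M.0#) (proj₁ L.isFinitelyGenerated) ++ map (L.0# ,_) (proj₁ M.isFinitelyGenerated)

  Spanned : Pred LM.Carrier 0ℓ
  Spanned = Generated LM.group (λ y → ∃₂ λ g m → m ∈ gens × y LM.≈ g LM.· m)

  inˡ : ∀ {x} → Generated L.group _ x → Spanned (x , M.0#)
  inˡ (gen (g , m , m∈ , y≈)) = gen (g , _ , ∈-++⁺ˡ (∈-map⁺ _ m∈) , y≈ , ·-zeroʳ g)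
  inˡ (resp x≈y p) = resp (x≈y , M.refl) (inˡ p)
  inˡ unit         = unit
  inˡ (mul p q)    = resp (L.refl , M.identityˡ _) (mul (inˡ p) (inˡ q))
  inˡ (inv p)      = resp (L.refl , GroupProperties.ε⁻¹≈ε M.group) (inv (inˡ p))

  inʳ : ∀ {y} → Generated M.group _ y → Spanned (L.0# , y)
  inʳ (gen (g , m , m∈ , y≈)) = gen (g , _ , ∈-++⁺ʳ _ (∈-map⁺ _ m∈) , ·-zeroˡ g , y≈)
  inʳ (resp x≈y p) = resp (L.refl , x≈y) (inʳ p)
  inʳ unit         = unit
  inʳ (mul p q)    = resp (L.identityˡ _ , M.refl) (mul (inʳ p) (inʳ q))
  inʳ (inv p)      = resp (GroupProperties.ε⁻¹≈ε L.group , M.refl) (inv (inʳ p))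

  open RawMonoidDefs L.rawMonoid  using () renaming (_×_ to _⋆ˡ_)
  open RawMonoidDefs M.rawMonoid  using () renaming (_×_ to _⋆ʳ_)
  open RawMonoidDefs LM.rawMonoid using () renaming (_×_ to _⋆_)

  ⋆-proj₁ : ∀ k x y → proj₁ (k ⋆ (x , y)) L.≈ k ⋆ˡ x
  ⋆-proj₁ zero    x y = L.refl
  ⋆-proj₁ (suc k) x y = L.∙-congˡ (⋆-proj₁ k x y)

  ⋆-proj₂ : ∀ k x y → proj₂ (k ⋆ (x , y)) M.≈ k ⋆ʳ y
  ⋆-proj₂ zero    x y = M.refl
  ⋆-proj₂ (suc k) x y = M.∙-congˡ (⋆-proj₂ k x y)

------------------------------------------------------------------------
-- Additive maps

record IsAdditive (A B : AbelianGroup 0ℓ 0ℓ)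
                  (f : AbelianGroup.Carrier A → AbelianGroup.Carrier B) : Set where
  private
    module A = AbelianGroup A
    module B = AbelianGroup B
  field
    f-cong : ∀ {x y} → x A.≈ y → f x B.≈ f y
    f-+    : ∀ x y → f (x A.∙ y) B.≈ f x B.∙ f y

  f-0 : f A.ε B.≈ B.ε
  f-0 = GroupProperties.identityʳ-unique B.group (f A.ε) (f A.ε)
    (B.trans (B.sym (f-+ A.ε A.ε)) (f-cong (A.identityˡ A.ε)))

  f-neg : ∀ x → f (x A.⁻¹) B.≈ f x B.⁻¹
  f-neg x = GroupProperties.inverseˡ-unique B.group (f (x A.⁻¹)) (f x)
    (B.trans (B.sym (f-+ (x A.⁻¹) x)) (B.trans (f-cong (A.inverseˡ x)) f-0))

  f-sum : ∀ {k} (v : Fin k → A.Carrier) →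
          f (Sum.sum A.commutativeMonoid v) B.≈ Sum.sum B.commutativeMonoid (f ∘ v)
  f-sum {zero}  v = f-0
  f-sum {suc k} v = B.trans (f-+ _ _) (B.∙-congˡ (f-sum (v ∘ suc)))

module _ {A B : AbelianGroup 0ℓ 0ℓ} where
  private
    module A = AbelianGroup A
    module B = AbelianGroup B

  agree-on-generators : {P : Pred A.Carrier 0ℓ} → (∀ a → Generated A.group P a) →
    ∀ {f g} → IsAdditive A B f → IsAdditive A B g →
    (∀ {a} → P a → f a B.≈ g a) → ∀ a → f a B.≈ g a
  agree-on-generators {P} generates {f} {g} f-add g-add f≈g a = go (generates a)
    where
    module F = IsAdditive f-add
    module G = IsAdditive g-add
    go : ∀ {a} → Generated A.group P a → f a B.≈ g a
    go (gen p)      = f≈g p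
    go (resp a≈b p) = B.trans (B.sym (F.f-cong a≈b)) (B.trans (go p) (G.f-cong a≈b))
    go unit         = B.trans F.f-0 (B.sym G.f-0)
    go (mul p q)    = B.trans (F.f-+ _ _) (B.trans (B.∙-cong (go p) (go q)) (B.sym (G.f-+ _ _)))
    go (inv p)      = B.trans (F.f-neg _) (B.trans (B.⁻¹-cong (go p)) (B.sym (G.f-neg _)))

∘-additive : ∀ {A B C f g} → IsAdditive B C g → IsAdditive A B f → IsAdditive A C (g ∘ f)
∘-additive {C = C} g-add f-add = record
  { f-cong = G.f-cong ∘ F.f-cong
  ; f-+    = λ x y → AbelianGroup.trans C (G.f-cong (F.f-+ x y)) (G.f-+ _ _)
  }
  where
  module F = IsAdditive f-add
  module G = IsAdditive g-add

id-additive : ∀ A → IsAdditive A A id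
id-additive A = record { f-cong = id ; f-+ = λ _ _ → AbelianGroup.refl A }

fold-additive : ∀ {A f} → IsAdditive A A f → ∀ k → IsAdditive A A (λ x → fold x f k)
fold-additive {A} f-add zero    = id-additive A
fold-additive {A} f-add (suc k) = ∘-additive {A} {A} {A} f-add (fold-additive f-add k)

------------------------------------------------------------------------
-- The free abelian group on a finite set

record Finite (X : Setoid 0ℓ 0ℓ) : Set where
  field
    size        : ℕ
    enumeration : Inverse (≡.setoid (Fin size)) X
  open Inverse enumeration public using (strictlyInverseˡ; strictlyInverseʳ)
    renaming (to to element; from to index; to-cong to element-cong; from-cong to index-cong)

-- An element ∑ₓ aₓ x of the free abelian group on X is given by its
-- coefficients aₓ; no support condition is needed since X is finite.
module Free (X : Setoid 0ℓ 0ℓ) (finite : Finite X) where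

  private module X = Setoid X
  open Finite finite

  infix 4 _≐_
  record _≐_ (a b : Func X (≡.setoid ℤ)) : Set where
    constructor pointwise
    field
      at : ∀ x → a ⟨$⟩ x ≡ b ⟨$⟩ x
  open _≐_ public

  abelianGroup : AbelianGroup 0ℓ 0ℓ
  abelianGroup = record
    { Carrier = Func X (≡.setoid ℤ)
    ; _≈_     = _≐_
    ; _∙_     = λ a b → record
        { to   = λ x → (a ⟨$⟩ x) ℤ.+ (b ⟨$⟩ x)
        ; cong = λ p → cong₂ ℤ._+_ (Func.cong a p) (Func.cong b p) }
    ; ε       = record { to = λ _ → 0ℤ ; cong = λ _ → refl }
    ; _⁻¹     = λ a → record { to = λ x → ℤ.- (a ⟨$⟩ x) ; cong = λ p → cong ℤ.-_ (Func.cong a p) }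
    ; isAbelianGroup = record
      { isGroup = record
        { isMonoid = record
          { isSemigroup = record
            { isMagma = record
              { isEquivalence = record
                { refl  = pointwise λ _ → refl
                ; sym   = λ p → pointwise λ x → ≡.sym (at p x)
                ; trans = λ p q → pointwise λ x → ≡.trans (at p x) (at q x) }
              ; ∙-cong = λ p q → pointwise λ x → cong₂ ℤ._+_ (at p x) (at q x) }
            ; assoc = λ a b c → pointwise λ x → ℤ.+-assoc (a ⟨$⟩ x) (b ⟨$⟩ x) (c ⟨$⟩ x) }
          ; identity = (λ a → pointwise λ x → ℤ.+-identityˡ (a ⟨$⟩ x))
                     , (λ a → pointwise λ x → ℤ.+-identityʳ (a ⟨$⟩ x)) }
        ; inverse = (λ a → pointwise λ x → ℤ.+-inverseˡ (a ⟨$⟩ x))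
                  , (λ a → pointwise λ x → ℤ.+-inverseʳ (a ⟨$⟩ x))
        ; ⁻¹-cong = λ p → pointwise λ x → cong ℤ.-_ (at p x) }
      ; comm = λ a b → pointwise λ x → ℤ.+-comm (a ⟨$⟩ x) (b ⟨$⟩ x) }
    }

  open AbelianGroup abelianGroup public
    renaming (_∙_ to _+_; ε to 0#; _⁻¹ to -_; sym to ≈-sym; trans to ≈-trans; refl to ≈-refl)
  open Sum commutativeMonoid public using (sum; sum-cong-≋; sum-permute)
  open RawMonoidDefs rawMonoid public renaming (_×_ to _⋆_) using ()

  -- The basis element of x.
  δ : X.Carrier → Carrier
  δ x = record
    { to   = λ y → if does (index x ≟ᶠ index y) then 1ℤ else 0ℤ
    ; cong = λ p → cong (λ j → if does (index x ≟ᶠ j) then 1ℤ else 0ℤ) (index-cong p)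
    }

  δ-cong : ∀ {x y} → x X.≈ y → δ x ≈ δ y
  δ-cong p = pointwise λ z → cong (λ j → if does (j ≟ᶠ index z) then 1ℤ else 0ℤ) (index-cong p)

  infixr 7 _•_
  _•_ : ℤ → Carrier → Carrier
  c • a = record { to = λ x → c ℤ.* (a ⟨$⟩ x) ; cong = λ p → cong (c ℤ.*_) (Func.cong a p) }

  -- The additive map sending the basis element of x to φ x.
  extend : (X.Carrier → Carrier) → Carrier → Carrier
  extend φ a = sum {size} (λ j → (a ⟨$⟩ element j) • φ (element j))

  private
    module Σℤ = Sum (AbelianGroup.commutativeMonoid ℤ.+-0-abelianGroup)

    sum-eval : ∀ {k} (v : Fin k → Carrier) x → sum v ⟨$⟩ x ≡ Σℤ.sum (λ j → v j ⟨$⟩ x)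
    sum-eval {zero}  v x = refl
    sum-eval {suc k} v x = cong (ℤ._+_ (v zero ⟨$⟩ x)) (sum-eval (v ∘ suc) x)

    ind : ∀ {k} → Fin k → Fin k → ℤ
    ind i j = if does (i ≟ᶠ j) then 1ℤ else 0ℤ

    sum-0 : ∀ {k} (f : Fin k → ℤ) → (∀ j → f j ≡ 0ℤ) → Σℤ.sum f ≡ 0ℤ
    sum-0 {k} f p = ≡.trans (Σℤ.sum-cong-≗ p) (Σℤ.sum-replicate-zero k)

    sum-indʳ : ∀ {k} (f : Fin k → ℤ) i → Σℤ.sum (λ j → f j ℤ.* ind j i) ≡ f i
    sum-indʳ f zero = ≡.trans (cong₂ ℤ._+_ (ℤ.*-identityʳ (f zero)) (sum-0 _ (λ j → ℤ.*-zeroʳ (f (suc j)))))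
                              (ℤ.+-identityʳ (f zero))
    sum-indʳ f (suc i) = ≡.trans (cong₂ ℤ._+_ (ℤ.*-zeroʳ (f zero)) (sum-indʳ (f ∘ suc) i)) (ℤ.+-identityˡ _)

    sum-indˡ : ∀ {k} (f : Fin k → ℤ) i → Σℤ.sum (λ j → ind i j ℤ.* f j) ≡ f i
    sum-indˡ f zero = ≡.trans (cong₂ ℤ._+_ (ℤ.*-identityˡ (f zero)) (sum-0 _ (λ j → ℤ.*-zeroˡ (f (suc j)))))
                              (ℤ.+-identityʳ (f zero))
    sum-indˡ f (suc i) = ≡.trans (cong₂ ℤ._+_ (ℤ.*-zeroˡ (f zero)) (sum-indˡ (f ∘ suc) i)) (ℤ.+-identityˡ _)

  δ-expansion : ∀ a → sum {size} (λ j → (a ⟨$⟩ element j) • δ (element j)) ≈ a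
  δ-expansion a = pointwise λ x → begin
    sum {size} (λ j → (a ⟨$⟩ element j) • δ (element j)) ⟨$⟩ x
      ≡⟨ sum-eval {size} _ x ⟩
    Σℤ.sum {size} (λ j → (a ⟨$⟩ element j) ℤ.* ind (index (element j)) (index x))
      ≡⟨ Σℤ.sum-cong-≗ {size} (λ j → cong (λ i → (a ⟨$⟩ element j) ℤ.* ind i (index x)) (strictlyInverseʳ j)) ⟩
    Σℤ.sum {size} (λ j → (a ⟨$⟩ element j) ℤ.* ind j (index x))
      ≡⟨ sum-indʳ (λ j → a ⟨$⟩ element j) (index x) ⟩
    a ⟨$⟩ element (index x)
      ≡⟨ Func.cong a (strictlyInverseˡ x) ⟩
    a ⟨$⟩ x ∎
    where open ≡.≡-Reasoning

  extend-δ : ∀ φ → (∀ {x y} → x X.≈ y → φ x ≈ φ y) → ∀ x → extend φ (δ x) ≈ φ x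
  extend-δ φ φ-cong x = pointwise λ y → begin
    extend φ (δ x) ⟨$⟩ y
      ≡⟨ sum-eval {size} _ y ⟩
    Σℤ.sum {size} (λ j → ind (index x) (index (element j)) ℤ.* (φ (element j) ⟨$⟩ y))
      ≡⟨ Σℤ.sum-cong-≗ {size} (λ j → cong (λ i → ind (index x) i ℤ.* (φ (element j) ⟨$⟩ y)) (strictlyInverseʳ j)) ⟩
    Σℤ.sum {size} (λ j → ind (index x) j ℤ.* (φ (element j) ⟨$⟩ y))
      ≡⟨ sum-indˡ (λ j → φ (element j) ⟨$⟩ y) (index x) ⟩
    φ (element (index x)) ⟨$⟩ y
      ≡⟨ at (φ-cong (strictlyInverseˡ x)) y ⟩
    φ x ⟨$⟩ y ∎
    where open ≡.≡-Reasoning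

  extend-cong : ∀ φ {a b} → a ≈ b → extend φ a ≈ extend φ b
  extend-cong φ a≈b = sum-cong-≋ {size} (λ j → pointwise λ y → cong (ℤ._* (φ (element j) ⟨$⟩ y)) (at a≈b (element j)))

  extend-+ : ∀ φ a b → extend φ (a + b) ≈ extend φ a + extend φ b
  extend-+ φ a b = ≈-trans
    (sum-cong-≋ {size} (λ j → pointwise λ y → ℤ.*-distribʳ-+ (φ (element j) ⟨$⟩ y) (a ⟨$⟩ element j) (b ⟨$⟩ element j)))
    (Sum.∑-distrib-+ commutativeMonoid {size} _ _)

  isTorsionFree : ∀ k .{{_ : NonZero k}} a → k ⋆ a ≈ 0# → a ≈ 0#
  isTorsionFree (suc k) a p = pointwise λ x → ℤ.*-cancelˡ-≡ (+ suc k) (a ⟨$⟩ x) 0ℤ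
    (≡.trans (≡.sym (⋆-eval (suc k) x)) (≡.trans (at p x) (≡.sym (ℤ.*-zeroʳ (+ suc k)))))
    where
    ⋆-eval : ∀ k x → (k ⋆ a) ⟨$⟩ x ≡ + k ℤ.* (a ⟨$⟩ x)
    ⋆-eval zero    x = ≡.sym (ℤ.*-zeroˡ (a ⟨$⟩ x))
    ⋆-eval (suc k) x = ≡.trans (cong (ℤ._+_ (a ⟨$⟩ x)) (⋆-eval k x)) (≡.sym (ℤ.suc-* (+ k) (a ⟨$⟩ x)))

  generated : ∀ a → Generated group (λ y → ∃ λ j → y ≡ δ (element j)) a
  generated a = resp (δ-expansion a) (sums {size} (λ j → multiples (a ⟨$⟩ element j) (gen (j , refl))))
    where
    Spanned : Pred Carrier 0ℓ
    Spanned = Generated group (λ y → ∃ λ j → y ≡ δ (element j))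

    sums : ∀ {k} {v : Fin k → Carrier} → (∀ j → Spanned (v j)) → Spanned (sum v)
    sums {zero}  p = unit
    sums {suc k} p = mul (p zero) (sums (p ∘ suc))

    multiplesℕ : ∀ k {d} → Spanned d → Spanned ((+ k) • d)
    multiplesℕ zero    {d} p = resp (pointwise λ x → ≡.sym (ℤ.*-zeroˡ (d ⟨$⟩ x))) unit
    multiplesℕ (suc k) {d} p = resp (pointwise λ x → ≡.sym (ℤ.suc-* (+ k) (d ⟨$⟩ x))) (mul p (multiplesℕ k p))

    multiples : ∀ c {d} → Spanned d → Spanned (c • d)
    multiples (+ k)    p = multiplesℕ k p
    multiples -[1+ k ] {d} p =
      resp (pointwise λ x → ℤ.neg-distribˡ-* (+ suc k) (d ⟨$⟩ x)) (inv (multiplesℕ (suc k) p))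

  extend-additive : ∀ φ → IsAdditive abelianGroup abelianGroup (extend φ)
  extend-additive φ = record { f-cong = extend-cong φ ; f-+ = extend-+ φ }

  agree-on-basis : ∀ {A f g} → IsAdditive abelianGroup A f → IsAdditive abelianGroup A g →
    (∀ x → AbelianGroup._≈_ A (f (δ x)) (g (δ x))) → ∀ a → AbelianGroup._≈_ A (f a) (g a)
  agree-on-basis f-add g-add p =
    agree-on-generators generated f-add g-add (λ { (j , refl) → p (element j) })

------------------------------------------------------------------------
-- Permutation lattices

record GSet (G : Group 0ℓ 0ℓ) : Set₁ where
  infixr 7 _▹_
  private module G = Group G
  field
    setoid     : Setoid 0ℓ 0ℓ
  open Setoid setoid public
  field
    _▹_        : G.Carrier → Carrier → Carrier
    ▹-cong     : ∀ {g h x y} → g G.≈ h → x ≈ y → g ▹ x ≈ h ▹ y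
    ▹-assoc    : ∀ g h x → (g G.∙ h) ▹ x ≈ g ▹ h ▹ x
    ▹-identity : ∀ x → G.ε ▹ x ≈ x

module _ {G : Group 0ℓ 0ℓ} (X : GSet G) (finite : Finite (GSet.setoid X)) where
  private
    module G = Group G
    module X = GSet X
    module F = Free X.setoid finite
    module GP = GroupProperties G

  open Finite finite

  -- g · ∑ₓ aₓ x = ∑ₓ aₓ gx, that is, the coefficient of x in g · a is the
  -- coefficient of g⁻¹x in a.
  permutationModule : GModule G
  permutationModule = record
    { abelianGroup = F.abelianGroup
    ; _·_          = λ g a → record
        { to   = λ x → a ⟨$⟩ (g G.⁻¹ X.▹ x)
        ; cong = λ p → Func.cong a (X.▹-cong G.refl p) }
    ; ·-cong       = λ {_} {_} {a} g≈h a≈b → F.pointwise λ x →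
        ≡.trans (Func.cong a (X.▹-cong (G.⁻¹-cong g≈h) X.refl)) (F.at a≈b _)
    ; ·-distrib-+  = λ _ _ _ → F.pointwise λ _ → refl
    ; ·-assoc      = λ g h a → F.pointwise λ x → Func.cong a
        (X.trans (X.▹-cong (GP.⁻¹-anti-homo-∙ g h) X.refl) (X.▹-assoc _ _ x))
    ; ·-identity   = λ a → F.pointwise λ x → Func.cong a
        (X.trans (X.▹-cong GP.ε⁻¹≈ε X.refl) (X.▹-identity x))
    }

  open GModule permutationModule using (_·_)

  ·-δ : ∀ g x → g · F.δ x F.≈ F.δ (g X.▹ x)
  ·-δ g x = F.pointwise coefficient
    where
    index-injective : ∀ {x y} → index x ≡ index y → x X.≈ y
    index-injective {x} {y} p = X.trans (X.sym (strictlyInverseˡ x))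
      (X.trans (element-cong p) (strictlyInverseˡ y))

    coefficient : ∀ y → (g · F.δ x) ⟨$⟩ y ≡ F.δ (g X.▹ x) ⟨$⟩ y
    coefficient y with index x ≟ᶠ index (g G.⁻¹ X.▹ y) | index (g X.▹ x) ≟ᶠ index y
    ... | yes _ | yes _ = refl
    ... | no  _ | no  _ = refl
    ... | yes p | no  q = ⊥-elim (q (index-cong
          (X.trans (X.▹-cong G.refl (index-injective p))
          (X.trans (X.sym (X.▹-assoc _ _ y))
          (X.trans (X.▹-cong (G.inverseʳ g) X.refl) (X.▹-identity y))))))
    ... | no  p | yes q = ⊥-elim (p (index-cong
          (X.trans (X.sym (X.▹-identity x))
          (X.trans (X.▹-cong (G.sym (G.inverseˡ g)) X.refl)
          (X.trans (X.▹-assoc _ _ x) (X.▹-cong G.refl (index-injective q)))))))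

freeIsFinitelyGenerated : {G : Group 0ℓ 0ℓ} {X : Setoid 0ℓ 0ℓ} (finite : Finite X) (M : GModule G) →
  GModule.abelianGroup M ≡ Free.abelianGroup X finite → IsFinitelyGenerated M
freeIsFinitelyGenerated {G} {X} finite M refl =
  tabulate (F.δ ∘ element) , λ a → weaken (F.generated a)
  where
  module F = Free X finite
  module M = GModule M
  open Finite finite
  weaken : ∀ {a} → Generated F.group (λ y → ∃ λ j → y ≡ F.δ (element j)) a →
           Generated M.group (λ y → ∃₂ λ g m → m ∈ tabulate (F.δ ∘ element) × y M.≈ g M.· m) a
  weaken (gen (j , refl)) = gen (Group.ε G , _ , ∈-tabulate⁺ j , M.sym (M.·-identity _))
  weaken (resp p q)       = resp p (weaken q)
  weaken unit             = unit
  weaken (mul p q)        = mul (weaken p) (weaken q)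
  weaken (inv p)          = inv (weaken p)

permutationLattice : {G : Group 0ℓ 0ℓ} (X : GSet G) → Finite (GSet.setoid X) → GLattice G
permutationLattice X finite = record
  { gModule             = permutationModule X finite
  ; isFinitelyGenerated = freeIsFinitelyGenerated finite (permutationModule X finite) refl
  ; isTorsionFree       = Free.isTorsionFree (GSet.setoid X) finite
  }

regular : (G : Group 0ℓ 0ℓ) → GSet G
regular G = record
  { setoid     = setoid
  ; _▹_        = _∙_
  ; ▹-cong     = ∙-cong
  ; ▹-assoc    = assoc
  ; ▹-identity = identityˡ
  }
  where open Group G

-- The coset xS is represented by x, with xS = yS when x⁻¹y ∈ S.
leftCosets : (G : Group 0ℓ 0ℓ) → Subgroup G → GSet G
leftCosets G S = record
  { setoid     = record
    { Carrier       = Carrier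
    ; _≈_           = λ x y → Member (x ⁻¹ ∙ y)
    ; isEquivalence = record
      { refl  = λ {x} → ≈-closed (sym (inverseˡ x)) ε-closed
      ; sym   = λ {x} {y} p → ≈-closed (trans (⁻¹-anti-homo-∙ (x ⁻¹) y) (∙-congˡ (⁻¹-involutive x))) (⁻¹-closed p)
      ; trans = λ {x} {y} {z} p q → ≈-closed
          (trans (assoc _ _ _) (∙-congˡ (trans (sym (assoc _ _ _)) (trans (∙-congʳ (inverseʳ y)) (identityˡ z)))))
          (∙-closed p q) } }
  ; _▹_        = _∙_
  ; ▹-cong     = λ {g} {h} {x} {y} g≈h p → ≈-closed (sym (translate g h x y g≈h)) p
  ; ▹-assoc    = λ g h x → equal (assoc g h x)
  ; ▹-identity = λ x → equal (identityˡ x)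
  }
  where
  open Group G
  open GroupProperties G
  open Subgroup S
  translate : ∀ g h x y → g ≈ h → (g ∙ x) ⁻¹ ∙ (h ∙ y) ≈ x ⁻¹ ∙ y
  translate g h x y g≈h = trans (∙-congʳ (⁻¹-anti-homo-∙ g x)) (trans (assoc _ _ _) (∙-congˡ
    (trans (sym (assoc _ _ _)) (trans (∙-congʳ (trans (∙-congʳ (⁻¹-cong g≈h)) (inverseˡ h))) (identityˡ y)))))
  equal : ∀ {x y} → x ≈ y → Member (x ⁻¹ ∙ y)
  equal {x} {y} x≈y = ≈-closed (sym (trans (∙-congˡ (sym x≈y)) (inverseˡ x))) ε-closed

------------------------------------------------------------------------
-- Residues modulo n

module Residues (n : ℕ) .{{_ : NonZero n}} where

  infixl 6 _⊞_
  _⊞_ : Fin n → Fin n → Fin n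
  i ⊞ j = (toℕ i ℕ.+ toℕ j) mod n

  ⊟_ : Fin n → Fin n
  ⊟ i = (n ∸ toℕ i) mod n

  toℕ-mod : ∀ k → toℕ (k mod n) ≡ k % n
  toℕ-mod k = toℕ-fromℕ< (m%n<n k n)

  mod-cong : ∀ {k l} → k % n ≡ l % n → k mod n ≡ l mod n
  mod-cong {k} {l} p = toℕ-injective (≡.trans (toℕ-mod k) (≡.trans p (≡.sym (toℕ-mod l))))

  toℕ%n : ∀ (i : Fin n) → toℕ i % n ≡ toℕ i
  toℕ%n i = m<n⇒m%n≡m (toℕ<n i)

  mod-toℕ : ∀ i → toℕ i mod n ≡ i
  mod-toℕ i = toℕ-injective (≡.trans (toℕ-mod (toℕ i)) (toℕ%n i))

  mod-+ : ∀ k l → (k mod n) ⊞ (l mod n) ≡ (k ℕ.+ l) mod n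
  mod-+ k l = mod-cong (≡.trans (≡.cong₂ (λ x y → (x ℕ.+ y) % n) (toℕ-mod k) (toℕ-mod l)) (≡.sym (%-distribˡ-+ k l n)))

  ⊞-assoc : ∀ i j k → (i ⊞ j) ⊞ k ≡ i ⊞ (j ⊞ k)
  ⊞-assoc i j k = begin
    (i ⊞ j) ⊞ k                              ≡⟨ cong ((i ⊞ j) ⊞_) (mod-toℕ k) ⟨
    (i ⊞ j) ⊞ (toℕ k mod n)                  ≡⟨ mod-+ (toℕ i ℕ.+ toℕ j) (toℕ k) ⟩
    (toℕ i ℕ.+ toℕ j ℕ.+ toℕ k) mod n        ≡⟨ cong (_mod n) (ℕ.+-assoc (toℕ i) (toℕ j) (toℕ k)) ⟩
    (toℕ i ℕ.+ (toℕ j ℕ.+ toℕ k)) mod n      ≡⟨ mod-+ (toℕ i) (toℕ j ℕ.+ toℕ k) ⟨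
    (toℕ i mod n) ⊞ (j ⊞ k)                  ≡⟨ cong (_⊞ (j ⊞ k)) (mod-toℕ i) ⟩
    i ⊞ (j ⊞ k)                              ∎
    where open ≡.≡-Reasoning

  ⊞-comm : ∀ i j → i ⊞ j ≡ j ⊞ i
  ⊞-comm i j = cong (_mod n) (ℕ.+-comm (toℕ i) (toℕ j))

  ⊞-identityˡ : ∀ i → (0 mod n) ⊞ i ≡ i
  ⊞-identityˡ i = ≡.trans (cong ((0 mod n) ⊞_) (≡.sym (mod-toℕ i))) (≡.trans (mod-+ 0 (toℕ i)) (mod-toℕ i))

  n-mod-n : n mod n ≡ 0 mod n
  n-mod-n = mod-cong (≡.trans (n%n≡0 n) (≡.sym (m<n⇒m%n≡m (ℕ.>-nonZero⁻¹ n))))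

  ⊞-inverseʳ : ∀ i → i ⊞ (⊟ i) ≡ 0 mod n
  ⊞-inverseʳ i = begin
    i ⊞ (⊟ i)                     ≡⟨ cong (_⊞ (⊟ i)) (mod-toℕ i) ⟨
    (toℕ i mod n) ⊞ (⊟ i)         ≡⟨ mod-+ (toℕ i) (n ∸ toℕ i) ⟩
    (toℕ i ℕ.+ (n ∸ toℕ i)) mod n ≡⟨ cong (_mod n) (ℕ.m+[n∸m]≡n (ℕ.<⇒≤ (toℕ<n i))) ⟩
    n mod n                       ≡⟨ n-mod-n ⟩
    0 mod n                       ∎
    where open ≡.≡-Reasoning

  ℤ/n : AbelianGroup 0ℓ 0ℓ
  ℤ/n = record
    { Carrier = Fin n
    ; _≈_     = _≡_
    ; _∙_     = _⊞_
    ; ε       = 0 mod n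
    ; _⁻¹     = ⊟_
    ; isAbelianGroup = record
      { isGroup = record
        { isMonoid = record
          { isSemigroup = record
            { isMagma = record { isEquivalence = ≡.isEquivalence ; ∙-cong = cong₂ _⊞_ }
            ; assoc   = ⊞-assoc }
          ; identity = ⊞-identityˡ , λ i → ≡.trans (⊞-comm i _) (⊞-identityˡ i) }
        ; inverse = (λ i → ≡.trans (⊞-comm _ i) (⊞-inverseʳ i)) , ⊞-inverseʳ
        ; ⁻¹-cong = cong ⊟_ }
      ; comm = ⊞-comm }
    }

------------------------------------------------------------------------
-- The dihedral group

-- (i , b) stands for σⁱτᵇ, so that (i , b)(j , c) = (i ± j , b + c), the sign
-- being − exactly when b = 1.
module _ (n : ℕ) .{{_ : NonZero n}} where
  open Residues n
  private
    module Z = AbelianGroup ℤ/n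
    open AbelianGroupProperties ℤ/n
      using () renaming (⁻¹-involutive to ⊟-involutive; ε⁻¹≈ε to ⊟-zero; ⁻¹-∙-comm to ⊟-⊞-comm)

  twist : Bool → Fin n → Fin n
  twist false i = i
  twist true  i = ⊟ i

  private
    twist-⊞ : ∀ b i j → twist b (i ⊞ j) ≡ twist b i ⊞ twist b j
    twist-⊞ false i j = refl
    twist-⊞ true  i j = ≡.sym (⊟-⊞-comm i j)

    twist-xor : ∀ b c i → twist (b xor c) i ≡ twist b (twist c i)
    twist-xor false c     i = refl
    twist-xor true  false i = refl
    twist-xor true  true  i = ≡.sym (⊟-involutive i)

    twist-0 : ∀ b → twist b (0 mod n) ≡ 0 mod n
    twist-0 false = refl
    twist-0 true  = ⊟-zero

    twist-twist : ∀ b i → twist b (twist b i) ≡ i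
    twist-twist false i = refl
    twist-twist true  i = ⊟-involutive i

    twist-⊟ : ∀ b i → twist b i ⊞ twist b (⊟ i) ≡ 0 mod n
    twist-⊟ b i = ≡.trans (≡.sym (twist-⊞ b i (⊟ i))) (≡.trans (cong (twist b) (⊞-inverseʳ i)) (twist-0 b))

  D : Group 0ℓ 0ℓ
  D = record
    { Carrier = Fin n × Bool
    ; _≈_     = _≡_
    ; _∙_     = λ { (i , b) (j , c) → i ⊞ twist b j , b xor c }
    ; ε       = 0 mod n , false
    ; _⁻¹     = λ { (i , b) → twist b (⊟ i) , b }
    ; isGroup = record
      { isMonoid = record
        { isSemigroup = record
          { isMagma = record { isEquivalence = ≡.isEquivalence ; ∙-cong = cong₂ _ }
          ; assoc   = λ { (i , b) (j , c) (k , d) → cong₂ _,_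
              (≡.trans (⊞-assoc i _ _) (cong (i ⊞_)
                (≡.trans (cong (twist b j ⊞_) (twist-xor b c k)) (≡.sym (twist-⊞ b j (twist c k))))))
              (xor-assoc b c d) } }
        ; identity = (λ { (i , b) → cong (_, b) (⊞-identityˡ i) })
                   , (λ { (i , b) → cong₂ _,_ (≡.trans (cong (i ⊞_) (twist-0 b)) (Z.identityʳ i)) (xor-identityʳ b) }) }
      ; inverse = (λ { (i , b) → cong₂ _,_ (≡.trans (⊞-comm (twist b (⊟ i)) (twist b i)) (twist-⊟ b i)) (xor-same b) })
                , (λ { (i , b) → cong₂ _,_ (≡.trans (cong (i ⊞_) (twist-twist b (⊟ i))) (⊞-inverseʳ i)) (xor-same b) })
      ; ⁻¹-cong = cong (λ { (i , b) → twist b (⊟ i) , b }) }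
    }

  σ τ : Group.Carrier D
  σ = 1 mod n , false
  τ = 0 mod n , true

  private
    module D = Group D
    open RawMonoidDefs D.rawMonoid renaming (_×_ to _⋆_) using ()

  -- k ⋆ σ is the power σᵏ.
  σ-power : ∀ k → k ⋆ σ ≡ (k mod n , false)
  σ-power zero    = refl
  σ-power (suc k) = ≡.trans (cong (σ D.∙_) (σ-power k)) (cong (_, false) (mod-+ 1 k))

  σⁿ≡1 : n ⋆ σ ≡ D.ε
  σⁿ≡1 = ≡.trans (σ-power n) (cong (_, false) n-mod-n)

  τ²≡1 : τ D.∙ τ ≡ D.ε
  τ²≡1 = cong (_, false) (≡.trans (⊞-identityˡ _) ⊟-zero)

  τστ⁻¹≡σ⁻¹ : τ D.∙ σ D.∙ τ D.⁻¹ ≡ σ D.⁻¹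
  τστ⁻¹≡σ⁻¹ = cong (_, false) (≡.trans
    (cong₂ _⊞_ (⊞-identityˡ _) (≡.trans (⊟-involutive _) ⊟-zero)) (Z.identityʳ _))

  σⁱτᵇ : ∀ i b → (i , b) ≡ (toℕ i ⋆ σ) D.∙ (if b then τ else D.ε)
  σⁱτᵇ i false = ≡.trans (≡.sym (D.identityʳ _)) (cong (D._∙ D.ε) (≡.sym (≡.trans (σ-power (toℕ i)) (cong (_, false) (mod-toℕ i)))))
  σⁱτᵇ i true  = ≡.trans (cong (_, true) (≡.sym (Z.identityʳ i)))
    (cong (D._∙ τ) (≡.sym (≡.trans (σ-power (toℕ i)) (cong (_, false) (mod-toℕ i)))))

  D-finite : Finite D.setoid
  D-finite = record
    { size        = n ℕ.* 2
    ; enumeration = (↔-id (Fin n) ×-↔ 2↔Bool) ↔-∘ *↔×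
    }

  ⟨σ⟩ : Subgroup D
  ⟨σ⟩ = cyclic D σ

  ⟨σ⟩⇒ : ∀ {x} → Subgroup.Member ⟨σ⟩ x → proj₂ x ≡ false
  ⟨σ⟩⇒ (gen refl)    = refl
  ⟨σ⟩⇒ (resp refl p) = ⟨σ⟩⇒ p
  ⟨σ⟩⇒ unit          = refl
  ⟨σ⟩⇒ (mul p q)     = cong₂ _xor_ (⟨σ⟩⇒ p) (⟨σ⟩⇒ q)
  ⟨σ⟩⇒ (inv p)       = ⟨σ⟩⇒ p

  ⇒⟨σ⟩ : ∀ x → proj₂ x ≡ false → Subgroup.Member ⟨σ⟩ x
  ⇒⟨σ⟩ (i , _) refl = resp (≡.trans (σ-power (toℕ i)) (cong (_, false) (mod-toℕ i))) (powers (toℕ i))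
    where
    powers : ∀ k → Generated D (_≡ σ) (k ⋆ σ)
    powers zero    = unit
    powers (suc k) = mul (gen refl) (powers k)

  D/⟨σ⟩ : GSet D
  D/⟨σ⟩ = leftCosets D ⟨σ⟩

  D/⟨σ⟩-finite : Finite (GSet.setoid D/⟨σ⟩)
  D/⟨σ⟩-finite = record
    { size        = 2
    ; enumeration = record
      { to        = rep
      ; from      = λ { (_ , b) → 2↔B.from b }
      ; to-cong   = λ { {j} refl → C.refl {rep j} }
      ; from-cong = λ {x} {y} p → cong 2↔B.from (xor-≡ (proj₂ x) (proj₂ y) (⟨σ⟩⇒ p))
      ; inverse   = (λ { {x} refl → rep-from x }) , λ {j} {x} p →
          ≡.trans (cong 2↔B.from (xor-≡ (proj₂ x) (2↔B.to j) (⟨σ⟩⇒ p))) (2↔B.strictlyInverseʳ j)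
      }
    }
    where
    module C = GSet D/⟨σ⟩
    module 2↔B = Inverse 2↔Bool

    rep : Fin 2 → D.Carrier
    rep j = 0 mod n , 2↔B.to j

    xor-≡ : ∀ b c → b xor c ≡ false → b ≡ c
    xor-≡ false false _ = refl
    xor-≡ true  true  _ = refl

    rep-from : ∀ x → rep (2↔B.from (proj₂ x)) C.≈ x
    rep-from x = ⇒⟨σ⟩ _ (≡.trans (cong (_xor proj₂ x) (2↔B.strictlyInverseˡ (proj₂ x))) (xor-same (proj₂ x)))

  ℤ[D] : GLattice D
  ℤ[D] = permutationLattice (regular D) D-finite

  ℤ[D/⟨σ⟩] : GLattice D
  ℤ[D/⟨σ⟩] = permutationLattice D/⟨σ⟩ D/⟨σ⟩-finite

  module _ (A : AbelianGroup 0ℓ 0ℓ) where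
    open AbelianGroup A hiding (refl)

    -- The D-module structure on A in which σ and τ act by S and T.
    module FromGenerators
      {S T : Carrier → Carrier} (S-additive : IsAdditive A A S) (T-additive : IsAdditive A A T)
      (Sⁿ≈1   : ∀ x → fold x S n ≈ x)
      (T²≈1   : ∀ x → T (T x) ≈ x)
      (STST≈1 : ∀ x → S (T (S (T x))) ≈ x)
      where

      private
        module S = IsAdditive S-additive
        module T = IsAdditive T-additive

      T^ : Bool → Carrier → Carrier
      T^ false x = x
      T^ true  x = T x

      act : Fin n × Bool → Carrier → Carrier
      act (i , b) x = fold (T^ b x) S (toℕ i)

      private
        Sᵏ-additive : ∀ k → IsAdditive A A (λ x → fold x S k)
        Sᵏ-additive = fold-additive S-additive

        Tᵇ-additive : ∀ b → IsAdditive A A (T^ b)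
        Tᵇ-additive false = id-additive A
        Tᵇ-additive true  = T-additive

        Sᵏ-cong : ∀ k {x y} → x ≈ y → fold x S k ≈ fold y S k
        Sᵏ-cong k = IsAdditive.f-cong (Sᵏ-additive k)

        fold-+ : ∀ k l x → fold x S (k ℕ.+ l) ≡ fold (fold x S l) S k
        fold-+ zero    l x = refl
        fold-+ (suc k) l x = cong S (fold-+ k l x)

        Sᵏⁿ≈1 : ∀ k x → fold x S (k ℕ.* n) ≈ x
        Sᵏⁿ≈1 zero    x = AbelianGroup.refl A
        Sᵏⁿ≈1 (suc k) x = trans (reflexive (fold-+ n (k ℕ.* n) x)) (trans (Sⁿ≈1 _) (Sᵏⁿ≈1 k x))

        S^mod : ∀ k x → fold x S (toℕ (k mod n)) ≈ fold x S k
        S^mod k x = begin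
          fold x S (toℕ (k mod n))                     ≡⟨ cong (fold x S) (toℕ-mod k) ⟩
          fold x S (k % n)                             ≈⟨ Sᵏ-cong (k % n) (Sᵏⁿ≈1 (k / n) x) ⟨
          fold (fold x S ((k / n) ℕ.* n)) S (k % n)    ≡⟨ fold-+ (k % n) _ x ⟨
          fold x S (k % n ℕ.+ (k / n) ℕ.* n)           ≡⟨ cong (fold x S) (m≡m%n+[m/n]*n k n) ⟨
          fold x S k                                   ∎
          where open SetoidReasoning setoid

        STS≈T : ∀ x → S (T (S x)) ≈ T x
        STS≈T x = trans (S.f-cong (T.f-cong (S.f-cong (sym (T²≈1 x))))) (STST≈1 (T x))

        SᵏTSᵏ≈T : ∀ k x → fold (T (fold x S k)) S k ≈ T x
        SᵏTSᵏ≈T zero    x = AbelianGroup.refl A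
        SᵏTSᵏ≈T (suc k) x = begin
          S (fold (T (S (fold x S k))) S k)  ≡⟨ S-pull k _ ⟩
          fold (S (T (S (fold x S k)))) S k  ≈⟨ Sᵏ-cong k (STS≈T _) ⟩
          fold (T (fold x S k)) S k          ≈⟨ SᵏTSᵏ≈T k x ⟩
          T x                                ∎
          where
          open SetoidReasoning setoid
          S-pull : ∀ k y → S (fold y S k) ≡ fold (S y) S k
          S-pull zero    y = refl
          S-pull (suc k) y = cong S (S-pull k y)

        twisted : ∀ b j x → fold (T^ b x) S (toℕ (twist b j)) ≈ T^ b (fold x S (toℕ j))
        twisted false j x = AbelianGroup.refl A
        twisted true  j x = begin
          fold (T x) S (toℕ (⊟ j))                                ≈⟨ S^mod (n ∸ toℕ j) (T x) ⟩
          fold (T x) S (n ∸ toℕ j)                                ≈⟨ Sᵏ-cong (n ∸ toℕ j) (SᵏTSᵏ≈T (toℕ j) x) ⟨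
          fold (fold (T (fold x S (toℕ j))) S (toℕ j)) S (n ∸ toℕ j) ≡⟨ fold-+ (n ∸ toℕ j) (toℕ j) _ ⟨
          fold (T (fold x S (toℕ j))) S (n ∸ toℕ j ℕ.+ toℕ j)     ≡⟨ cong (fold _ S) (ℕ.m∸n+n≡m (ℕ.<⇒≤ (toℕ<n j))) ⟩
          fold (T (fold x S (toℕ j))) S n                         ≈⟨ Sⁿ≈1 _ ⟩
          T (fold x S (toℕ j))                                    ∎
          where open SetoidReasoning setoid

        T^-xor : ∀ b c x → T^ (b xor c) x ≈ T^ b (T^ c x)
        T^-xor false c     x = AbelianGroup.refl A
        T^-xor true  false x = AbelianGroup.refl A
        T^-xor true  true  x = sym (T²≈1 x)

        act-∙ : ∀ g h x → act (g D.∙ h) x ≈ act g (act h x)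
        act-∙ (i , b) (j , c) x = begin
          fold (T^ (b xor c) x) S (toℕ (i ⊞ twist b j))                  ≈⟨ S^mod (toℕ i ℕ.+ toℕ (twist b j)) _ ⟩
          fold (T^ (b xor c) x) S (toℕ i ℕ.+ toℕ (twist b j))            ≡⟨ fold-+ (toℕ i) _ _ ⟩
          fold (fold (T^ (b xor c) x) S (toℕ (twist b j))) S (toℕ i)     ≈⟨ Sᵏ-cong (toℕ i) (Sᵏ-cong (toℕ (twist b j)) (T^-xor b c x)) ⟩
          fold (fold (T^ b (T^ c x)) S (toℕ (twist b j))) S (toℕ i)      ≈⟨ Sᵏ-cong (toℕ i) (twisted b j (T^ c x)) ⟩
          fold (T^ b (fold (T^ c x) S (toℕ j))) S (toℕ i)                ∎
          where open SetoidReasoning setoid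

        act-additive : ∀ g → IsAdditive A A (act g)
        act-additive (i , b) = ∘-additive {A} {A} {A} (Sᵏ-additive (toℕ i)) (Tᵇ-additive b)

      gModule : GModule D
      gModule = record
        { abelianGroup = A
        ; _·_          = act
        ; ·-cong       = λ { {g} refl → IsAdditive.f-cong (act-additive g) }
        ; ·-distrib-+  = λ g → IsAdditive.f-+ (act-additive g)
        ; ·-assoc      = act-∙
        ; ·-identity   = S^mod 0
        }

      σ-acts : ∀ x → act σ x ≈ S x
      σ-acts = S^mod 1

      τ-acts : ∀ x → act τ x ≈ T x
      τ-acts x = S^mod 0 (T x)

------------------------------------------------------------------------
-- The lattices M̃₊ and M̃₋

-- The last basis element is called w′ in the case of M̃₋.
data Basis (n : ℕ) : Set where
  wᵢ : Fin n → Basis n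
  w  : Basis n

Basis-finite : ∀ n → Finite (≡.setoid (Basis n))
Basis-finite n = record
  { size        = suc n
  ; enumeration = mk↔ₛ′ to from to∘from from∘to
  }
  where
  to : Fin (suc n) → Basis n
  to zero    = w
  to (suc i) = wᵢ i
  from : Basis n → Fin (suc n)
  from w      = zero
  from (wᵢ i) = suc i
  to∘from : ∀ x → to (from x) ≡ x
  to∘from w      = refl
  to∘from (wᵢ i) = refl
  from∘to : ∀ i → from (to i) ≡ i
  from∘to zero    = refl
  from∘to (suc i) = refl

module _ (n : ℕ) .{{_ : NonZero n}} where
  open Residues n
  open Free (≡.setoid (Basis n)) (Basis-finite n)

  ∑w : Carrier
  ∑w = sum (λ i → δ (wᵢ i))

  σ-basis τ₊-basis τ₋-basis : Basis n → Carrier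

  σ-basis (wᵢ i) = δ (wᵢ (i ⊞ (1 mod n)))
  σ-basis w      = δ w

  τ₊-basis (wᵢ i) = δ (wᵢ (⊟ i))
  τ₊-basis w      = - δ w + ∑w

  τ₋-basis (wᵢ i) = - δ (wᵢ (⊟ i))
  τ₋-basis w      = δ w + - ∑w

  on-basis : ∀ φ x → extend φ (δ x) ≈ φ x
  on-basis φ = extend-δ φ (λ { refl → ≈-refl })

  private
    module Z = AbelianGroup ℤ/n

    S T₊ T₋ : Carrier → Carrier
    S  = extend σ-basis
    T₊ = extend τ₊-basis
    T₋ = extend τ₋-basis

    module S  = IsAdditive (extend-additive σ-basis)
    module T₊ = IsAdditive (extend-additive τ₊-basis)
    module T₋ = IsAdditive (extend-additive τ₋-basis)

    infixr 2 _⨾_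
    _⨾_ : ∀ {a b c} → a ≈ b → b ≈ c → a ≈ c
    _⨾_ {a} {b} {c} = ≈-trans {a} {b} {c}

    shift flip : Permutation n n
    shift = permutation (_⊞ (1 mod n)) (_⊞ (⊟ (1 mod n)))
      (λ i → ≡.trans (Z.assoc i _ _) (≡.trans (cong (i ⊞_) (Z.inverseˡ _)) (Z.identityʳ i)))
      (λ i → ≡.trans (Z.assoc i _ _) (≡.trans (cong (i ⊞_) (Z.inverseʳ _)) (Z.identityʳ i)))
    flip = permutation ⊟_ ⊟_ ⊟-involutive ⊟-involutive
      where open AbelianGroupProperties ℤ/n renaming (⁻¹-involutive to ⊟-involutive)

    S-∑ : S ∑w ≈ ∑w
    S-∑ = S.f-sum (λ i → δ (wᵢ i))
      ⨾ sum-cong-≋ {n} (λ i → on-basis σ-basis (wᵢ i))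
      ⨾ ≈-sym (sum-permute (λ i → δ (wᵢ i)) shift)

    ∑-flip : sum (λ i → δ (wᵢ (⊟ i))) ≈ ∑w
    ∑-flip = ≈-sym (sum-permute (λ i → δ (wᵢ i)) flip)

    T₊-∑ : T₊ ∑w ≈ ∑w
    T₊-∑ = T₊.f-sum (λ i → δ (wᵢ i))
      ⨾ sum-cong-≋ {n} (λ i → on-basis τ₊-basis (wᵢ i)) ⨾ ∑-flip

    T₋-∑ : T₋ ∑w ≈ - ∑w
    T₋-∑ = T₋.f-sum (λ i → δ (wᵢ i))
      ⨾ sum-cong-≋ {n} (λ i → on-basis τ₋-basis (wᵢ i))
      ⨾ ≈-sym (neg.f-sum (λ i → δ (wᵢ (⊟ i))))
      ⨾ neg.f-cong ∑-flip
      where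
      neg-additive : IsAdditive abelianGroup abelianGroup (λ a → - a)
      neg-additive = record
        { f-cong = λ {a} {b} → ⁻¹-cong {a} {b}
        ; f-+    = λ a b → pointwise λ x → ℤ.neg-distrib-+ (a ⟨$⟩ x) (b ⟨$⟩ x) }
      module neg = IsAdditive neg-additive

    Sᵏ-wᵢ : ∀ k i → fold (δ (wᵢ i)) S k ≈ δ (wᵢ (i ⊞ (k mod n)))
    Sᵏ-wᵢ zero    i = δ-cong (cong wᵢ (≡.sym (Z.identityʳ i)))
    Sᵏ-wᵢ (suc k) i = S.f-cong (Sᵏ-wᵢ k i) ⨾ on-basis σ-basis (wᵢ (i ⊞ (k mod n)))
      ⨾ δ-cong (cong wᵢ (≡.trans (Z.assoc i (k mod n) (1 mod n)) (cong (i ⊞_) (≡.trans (Z.comm (k mod n) (1 mod n)) (mod-+ 1 k)))))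

    Sᵏ-w : ∀ k → fold (δ w) S k ≈ δ w
    Sᵏ-w zero    = ≈-refl
    Sᵏ-w (suc k) = S.f-cong (Sᵏ-w k) ⨾ on-basis σ-basis w

    id-add : IsAdditive abelianGroup abelianGroup id
    id-add = id-additive abelianGroup

    _⊚_ : ∀ {f g} → IsAdditive abelianGroup abelianGroup f → IsAdditive abelianGroup abelianGroup g →
          IsAdditive abelianGroup abelianGroup (f ∘ g)
    _⊚_ = ∘-additive

    Sⁿ≈1 : ∀ a → fold a S n ≈ a
    Sⁿ≈1 = agree-on-basis (fold-additive (extend-additive σ-basis) n) id-add λ where
        (wᵢ i) → Sᵏ-wᵢ n i ⨾ δ-cong (cong wᵢ (≡.trans (cong (i ⊞_) n-mod-n) (Z.identityʳ i)))
        w      → Sᵏ-w n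

    open AbelianGroupProperties ℤ/n using ()
      renaming (⁻¹-involutive to ⊟-involutive; ⁻¹-∙-comm to ⊟-⊞-comm)

    shift-flip-shift-flip : ∀ i → ⊟ ((⊟ i) ⊞ (1 mod n)) ⊞ (1 mod n) ≡ i
    shift-flip-shift-flip i = ≡.trans (cong (_⊞ (1 mod n)) (≡.sym (⊟-⊞-comm (⊟ i) (1 mod n))))
      (≡.trans (Z.assoc _ _ _) (≡.trans (cong₂ _⊞_ (⊟-involutive i) (Z.inverseˡ _)) (Z.identityʳ i)))

    T₊-w : T₊ (δ w) ≈ - δ w + ∑w
    T₊-w = on-basis τ₊-basis w

    T₊²≈1 : ∀ a → T₊ (T₊ a) ≈ a
    T₊²≈1 = agree-on-basis (extend-additive τ₊-basis ⊚ extend-additive τ₊-basis) id-add λ where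
        (wᵢ i) → T₊.f-cong (on-basis τ₊-basis (wᵢ i)) ⨾ on-basis τ₊-basis (wᵢ (⊟ i))
                 ⨾ δ-cong (cong wᵢ (⊟-involutive i))
        w      → T₊.f-cong T₊-w ⨾ T₊-w′
      where
      T₊-w′ : T₊ (- δ w + ∑w) ≈ δ w
      T₊-w′ = pointwise λ x → let d = δ w ⟨$⟩ x ; s = ∑w ⟨$⟩ x in begin
        T₊ (- δ w + ∑w) ⟨$⟩ x                        ≡⟨ at (T₊.f-+ (- δ w) ∑w) x ⟩
        (T₊ (- δ w) ⟨$⟩ x) ℤ.+ (T₊ ∑w ⟨$⟩ x)         ≡⟨ cong₂ ℤ._+_ (at (T₊.f-neg (δ w)) x) (at T₊-∑ x) ⟩
        ℤ.- (T₊ (δ w) ⟨$⟩ x) ℤ.+ s                   ≡⟨ cong (λ z → ℤ.- z ℤ.+ s) (at T₊-w x) ⟩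
        ℤ.- (ℤ.- d ℤ.+ s) ℤ.+ s                      ≡⟨ cong (ℤ._+ s) (≡.trans (ℤ.neg-distrib-+ (ℤ.- d) s) (cong (ℤ._+ ℤ.- s) (ℤ.neg-involutive d))) ⟩
        d ℤ.+ ℤ.- s ℤ.+ s                            ≡⟨ ℤ.+-assoc d (ℤ.- s) s ⟩
        d ℤ.+ (ℤ.- s ℤ.+ s)                          ≡⟨ cong (λ z → d ℤ.+ z) (ℤ.+-inverseˡ s) ⟩
        d ℤ.+ 0ℤ                                     ≡⟨ ℤ.+-identityʳ d ⟩
        d                                            ∎
        where
        open ≡.≡-Reasoning

    S-T₊-w : S (T₊ (δ w)) ≈ T₊ (δ w)
    S-T₊-w = S.f-cong T₊-w ⨾ S.f-+ (- δ w) ∑w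
      ⨾ ∙-cong
          (S.f-neg (δ w) ⨾ ⁻¹-cong (on-basis σ-basis w)) S-∑
      ⨾ ≈-sym T₊-w

    ST₊ST₊≈1 : ∀ a → S (T₊ (S (T₊ a))) ≈ a
    ST₊ST₊≈1 = agree-on-basis (ST₊ ⊚ ST₊) id-add λ where
        (wᵢ i) → S.f-cong (T₊.f-cong (step i))
                 ⨾ step (⊟ i ⊞ (1 mod n)) ⨾ δ-cong (cong wᵢ (shift-flip-shift-flip i))
        w      → S.f-cong (T₊.f-cong S-T₊-w ⨾ T₊²≈1 (δ w))
                 ⨾ on-basis σ-basis w
      where
      ST₊ : IsAdditive abelianGroup abelianGroup (S ∘ T₊)
      ST₊ = extend-additive σ-basis ⊚ extend-additive τ₊-basis
      step : ∀ i → S (T₊ (δ (wᵢ i))) ≈ δ (wᵢ (⊟ i ⊞ (1 mod n)))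
      step i = S.f-cong (on-basis τ₊-basis (wᵢ i)) ⨾ on-basis σ-basis (wᵢ (⊟ i))

    T₋-w : T₋ (δ w) ≈ δ w + - ∑w
    T₋-w = on-basis τ₋-basis w

    T₋-neg-wᵢ : ∀ i → T₋ (- δ (wᵢ i)) ≈ δ (wᵢ (⊟ i))
    T₋-neg-wᵢ i = T₋.f-neg (δ (wᵢ i)) ⨾ ⁻¹-cong (on-basis τ₋-basis (wᵢ i))
      ⨾ pointwise (λ x → ℤ.neg-involutive (δ (wᵢ (⊟ i)) ⟨$⟩ x))

    T₋²≈1 : ∀ a → T₋ (T₋ a) ≈ a
    T₋²≈1 = agree-on-basis (extend-additive τ₋-basis ⊚ extend-additive τ₋-basis) id-add λ where
        (wᵢ i) → T₋.f-cong (on-basis τ₋-basis (wᵢ i)) ⨾ T₋-neg-wᵢ (⊟ i)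
                 ⨾ δ-cong (cong wᵢ (⊟-involutive i))
        w      → T₋.f-cong T₋-w ⨾ T₋-w′
      where
      T₋-w′ : T₋ (δ w + - ∑w) ≈ δ w
      T₋-w′ = pointwise λ x → let d = δ w ⟨$⟩ x ; s = ∑w ⟨$⟩ x in begin
        T₋ (δ w + - ∑w) ⟨$⟩ x                        ≡⟨ at (T₋.f-+ (δ w) (- ∑w)) x ⟩
        (T₋ (δ w) ⟨$⟩ x) ℤ.+ (T₋ (- ∑w) ⟨$⟩ x)       ≡⟨ cong₂ ℤ._+_ (at T₋-w x) (at (T₋.f-neg ∑w) x) ⟩
        d ℤ.+ ℤ.- s ℤ.+ ℤ.- (T₋ ∑w ⟨$⟩ x)            ≡⟨ cong (λ z → d ℤ.+ ℤ.- s ℤ.+ ℤ.- z) (at T₋-∑ x) ⟩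
        d ℤ.+ ℤ.- s ℤ.+ ℤ.- (ℤ.- s)                  ≡⟨ ℤ.+-assoc d (ℤ.- s) _ ⟩
        d ℤ.+ (ℤ.- s ℤ.+ ℤ.- (ℤ.- s))                ≡⟨ cong (λ z → d ℤ.+ z) (ℤ.+-inverseʳ (ℤ.- s)) ⟩
        d ℤ.+ 0ℤ                                     ≡⟨ ℤ.+-identityʳ d ⟩
        d                                            ∎
        where
        open ≡.≡-Reasoning

    S-T₋-w : S (T₋ (δ w)) ≈ T₋ (δ w)
    S-T₋-w = S.f-cong T₋-w ⨾ S.f-+ (δ w) (- ∑w)
      ⨾ ∙-cong (on-basis σ-basis w)
          (S.f-neg ∑w ⨾ ⁻¹-cong S-∑)
      ⨾ ≈-sym T₋-w

    ST₋ST₋≈1 : ∀ a → S (T₋ (S (T₋ a))) ≈ a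
    ST₋ST₋≈1 = agree-on-basis (ST₋ ⊚ ST₋) id-add λ where
        (wᵢ i) → S.f-cong (T₋.f-cong (step i)
                 ⨾ T₋-neg-wᵢ (⊟ i ⊞ (1 mod n)))
                 ⨾ on-basis σ-basis (wᵢ (⊟ (⊟ i ⊞ (1 mod n)))) ⨾ δ-cong (cong wᵢ (shift-flip-shift-flip i))
        w      → S.f-cong (T₋.f-cong S-T₋-w ⨾ T₋²≈1 (δ w))
                 ⨾ on-basis σ-basis w
      where
      ST₋ : IsAdditive abelianGroup abelianGroup (S ∘ T₋)
      ST₋ = extend-additive σ-basis ⊚ extend-additive τ₋-basis
      step : ∀ i → S (T₋ (δ (wᵢ i))) ≈ - δ (wᵢ (⊟ i ⊞ (1 mod n)))
      step i = S.f-cong (on-basis τ₋-basis (wᵢ i)) ⨾ S.f-neg (δ (wᵢ (⊟ i)))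
        ⨾ ⁻¹-cong (on-basis σ-basis (wᵢ (⊟ i)))

  private
    module Act₊ = FromGenerators n abelianGroup
      (extend-additive σ-basis) (extend-additive τ₊-basis) Sⁿ≈1 T₊²≈1 ST₊ST₊≈1
    module Act₋ = FromGenerators n abelianGroup
      (extend-additive σ-basis) (extend-additive τ₋-basis) Sⁿ≈1 T₋²≈1 ST₋ST₋≈1

  M̃₊ M̃₋ : GLattice (D n)
  M̃₊ = record
    { gModule             = Act₊.gModule
    ; isFinitelyGenerated = freeIsFinitelyGenerated (Basis-finite n) Act₊.gModule refl
    ; isTorsionFree       = isTorsionFree
    }
  M̃₋ = record
    { gModule             = Act₋.gModule
    ; isFinitelyGenerated = freeIsFinitelyGenerated (Basis-finite n) Act₋.gModule refl
    ; isTorsionFree       = isTorsionFree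
    }

  private
    module M̃₊ = GLattice M̃₊
    module M̃₋ = GLattice M̃₋

  M̃₊-σ : ∀ x → σ n M̃₊.· δ x ≈ σ-basis x
  M̃₊-σ x = Act₊.σ-acts (δ x) ⨾ on-basis σ-basis x

  M̃₊-τ : ∀ x → τ n M̃₊.· δ x ≈ τ₊-basis x
  M̃₊-τ x = Act₊.τ-acts (δ x) ⨾ on-basis τ₊-basis x

  M̃₋-σ : ∀ x → σ n M̃₋.· δ x ≈ σ-basis x
  M̃₋-σ x = Act₋.σ-acts (δ x) ⨾ on-basis σ-basis x

  M̃₋-τ : ∀ x → τ n M̃₋.· δ x ≈ τ₋-basis x
  M̃₋-τ x = Act₋.τ-acts (δ x) ⨾ on-basis τ₋-basis x

{-# OPTIONS --safe #-}

-- Take A = ∑ⱼ αⱼσʲ, where αⱼ is 1 on exactly one of j and −j for each j ≠ 0 and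
-- α₀ = 1. As n is odd, such A exists, and with A* = ∑ⱼ αⱼσ⁻ʲ, N = ∑ⱼ σʲ and
-- m = ∑ⱼ αⱼ one has A + A* = 1 + N, hence 2m = n + 1. Let e = ⟨σ⟩ and f = τ⟨σ⟩.
-- Then
--   w₀ ↦ A + A*τ + (e + f),   w  ↦ mN + me + (m − 1)f    on M̃₊,
--   w₀ ↦ 1 − τ,               w′ ↦ N + (e + f)           on M̃₋
-- is equivariant, and A + A* = 1 + N makes it invertible: if (u, v) are the
-- coefficients on σⁱ and σⁱτ and (r, s) those on e and f, then
--   x = u + v − rN,   c = r − s,   d = m(r + s) − ∑(u + v),   y = u − Ax − (mc + d)N
-- are the coefficients (x, c) in M̃₊ and (y, d) in M̃₋ of the preimage.
module Submission where

open import Defs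
open import Data.Nat using (ℕ; NonZero; _≤_)
open import Data.Nat.Divisibility using (_∣_)
open import Relation.Nullary using (¬_)

open import Algebra.Bundles using (Group; AbelianGroup)
import Algebra.Definitions.RawMonoid as RawMonoidDefs
import Algebra.Morphism.Structures as Morphism
import Algebra.Properties.AbelianGroup as AbelianGroupProperties
import Algebra.Properties.Semiring.Sum as Sum
open import Data.Bool.Base using (Bool; true; false; not; if_then_else_)
open import Data.Bool.Properties using (xor-same)
open import Data.Fin.Base using (Fin; zero; suc; toℕ)
open import Data.Fin.Permutation using (permutation)
open import Data.Fin.Properties using (toℕ<n) renaming (_≟_ to _≟ᶠ_)
open import Data.Integer.Base as ℤ using (ℤ; 0ℤ; 1ℤ; _+_; _*_; -_)
import Data.Integer.Properties as ℤ
open import Data.Integer.Tactic.RingSolver using (solve-∀)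
import Data.Nat.Base as ℕ
open import Data.Nat.Divisibility using (divides)
open import Data.Nat.DivMod using (_mod_; m<n⇒m%n≡m)
import Data.Nat.Properties as ℕ
open import Data.Product.Base using (_×_; _,_; proj₁; proj₂)
open import Data.Sum.Base as ⊎ using (_⊎_; inj₁; inj₂)
open import Function.Base using (_∘_)
open import Function.Bundles using (Func; _⟨$⟩_; mk⇔)
open import Level using (0ℓ)
open import Relation.Binary.PropositionalEquality as ≡
  using (_≡_; _≗_; refl; sym; trans; cong; cong₂; subst; module ≡-Reasoning)
open import Relation.Nullary.Decidable.Core using (Dec; does; yes; no)
open import Relation.Nullary.Decidable using (does-⇔)
open import Relation.Nullary.Negation using (contradiction)

open Sum ℤ.+-*-semiring using (sum; sum-cong-≗; sum-permute; ∑-distrib-+;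
  *-distribʳ-sum; sum-replicate-zero)

-- Sums of integers against indicator functions.

sum-indicator : ∀ {k} (f : Fin k → ℤ) i →
  sum (λ j → (if does (j ≟ᶠ i) then 1ℤ else 0ℤ) * f j) ≡ f i
sum-indicator {ℕ.suc k} f zero = begin
  1ℤ * f zero + sum (λ j → 0ℤ * f (suc j)) ≡⟨ cong₂ _+_ (ℤ.*-identityˡ (f zero)) (sum-cong-≗ {k} (λ j → ℤ.*-zeroˡ (f (suc j)))) ⟩
  f zero + sum {k} (λ _ → 0ℤ)              ≡⟨ cong (f zero +_) (sum-replicate-zero k) ⟩
  f zero + 0ℤ                              ≡⟨ ℤ.+-identityʳ _ ⟩
  f zero                                   ∎
  where open ≡-Reasoning
sum-indicator f (suc i) = begin
  0ℤ * f zero + sum (λ j → (if does (j ≟ᶠ i) then 1ℤ else 0ℤ) * f (suc j)) ≡⟨ cong₂ _+_ (ℤ.*-zeroˡ (f zero)) (sum-indicator (f ∘ suc) i) ⟩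
  0ℤ + f (suc i)                                                          ≡⟨ ℤ.+-identityˡ _ ⟩
  f (suc i)                                                               ∎
  where open ≡-Reasoning

-- Inclusion-exclusion for two events that together cover everything, with `R` as their
-- intersection.
indicator-⊎ : {P Q R : Set} (p? : Dec P) (q? : Dec Q) (r? : Dec R) →
  P ⊎ Q → (P → Q → R) → (R → P × Q) →
  (if does p? then 1ℤ else 0ℤ) + (if does q? then 1ℤ else 0ℤ) ≡ 1ℤ + (if does r? then 1ℤ else 0ℤ)
indicator-⊎ (yes _) (yes _) (yes _) _ _ _ = refl
indicator-⊎ (yes _) (no _)  (no _)  _ _ _ = refl
indicator-⊎ (no _)  (yes _) (no _)  _ _ _ = refl
indicator-⊎ (yes p) (yes q) (no ¬r) _ pq⇒r _ = contradiction (pq⇒r p q) ¬r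
indicator-⊎ (no ¬p) _ (yes r) _ _ r⇒pq = contradiction (proj₁ (r⇒pq r)) ¬p
indicator-⊎ (yes _) (no ¬q) (yes r) _ _ r⇒pq = contradiction (proj₂ (r⇒pq r)) ¬q
indicator-⊎ (no ¬p) (no _) (no _) (inj₁ p) _ _ = contradiction p ¬p
indicator-⊎ (no _) (no ¬q) (no _) (inj₂ q) _ _ = contradiction q ¬q

-- Convolution operators on integer functions on ℤ/n for odd n.

module OddResidues (n : ℕ) .{{_ : NonZero n}} (n-odd : ¬ (2 ∣ n)) where

  open Residues n
  private module Z = AbelianGroup ℤ/n
  open AbelianGroupProperties ℤ/n using (\\-leftDividesˡ; \\-leftDividesʳ)
    renaming (⁻¹-involutive to ⊟-involutive; ⁻¹-∙-comm to ⊟-⊞-comm; ε⁻¹≈ε to ⊟-zero)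

  -- Oddness enters here: for `i` ≠ 0 the representative of -i is n - i, so equality with `i` would
  -- give n = 2i.
  ⊟-self : ∀ i → toℕ i ≡ toℕ (⊟ i) → i ≡ 0 mod n
  ⊟-self i i≡-i with toℕ i ℕ.≟ 0
  ... | yes i≡0 = trans (sym (mod-toℕ i)) (cong (_mod n) i≡0)
  ... | no  i≢0 = contradiction (divides (toℕ i) n≡i*2) n-odd
    where
    open ≡-Reasoning
    n∸i≡i : n ℕ.∸ toℕ i ≡ toℕ i
    n∸i≡i = begin
      n ℕ.∸ toℕ i           ≡⟨ m<n⇒m%n≡m (ℕ.∸-monoʳ-< (ℕ.n≢0⇒n>0 i≢0) (ℕ.<⇒≤ (toℕ<n i))) ⟨
      (n ℕ.∸ toℕ i) ℕ.% n   ≡⟨ toℕ-mod (n ℕ.∸ toℕ i) ⟨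
      toℕ (⊟ i)             ≡⟨ i≡-i ⟨
      toℕ i                 ∎
    n≡i*2 : n ≡ toℕ i ℕ.* 2
    n≡i*2 = begin
      n                         ≡⟨ ℕ.m∸n+n≡m (ℕ.<⇒≤ (toℕ<n i)) ⟨
      n ℕ.∸ toℕ i ℕ.+ toℕ i     ≡⟨ cong (ℕ._+ toℕ i) n∸i≡i ⟩
      toℕ i ℕ.+ toℕ i           ≡⟨ cong (toℕ i ℕ.+_) (ℕ.+-identityʳ (toℕ i)) ⟨
      2 ℕ.* toℕ i               ≡⟨ ℕ.*-comm 2 (toℕ i) ⟩
      toℕ i ℕ.* 2               ∎

  -- One residue is chosen from each pair {j, -j}: the one with the smaller representative in 0,
  -- ..., n - 1. The choice at 0 is 1.
  α : Fin n → ℤ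
  α j = if does (toℕ j ℕ.≤? toℕ (⊟ j)) then 1ℤ else 0ℤ

  -- This is A + A* = 1 + N read off coefficient by coefficient. Totality of the order selects at
  -- least one of j and -j. By antisymmetry and `⊟-self`, both are selected only at 0.
  α+α⊟ : ∀ j → α j + α (⊟ j) ≡ 1ℤ + (if does (j ≟ᶠ 0 mod n) then 1ℤ else 0ℤ)
  α+α⊟ j = indicator-⊎ (toℕ j ℕ.≤? toℕ (⊟ j)) (toℕ (⊟ j) ℕ.≤? toℕ (⊟ (⊟ j))) (j ≟ᶠ 0 mod n)
    (⊎.map₂ (subst (λ k → toℕ (⊟ j) ≤ toℕ k) (sym (⊟-involutive j))) (ℕ.≤-total (toℕ j) (toℕ (⊟ j))))
    (λ p q → ⊟-self j (ℕ.≤-antisym p (subst (λ k → toℕ (⊟ j) ≤ toℕ k) (⊟-involutive j) q)))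
    (λ { refl → ℕ.≤-reflexive (cong toℕ (sym ⊟-zero)) , ℕ.≤-reflexive (cong (toℕ ∘ ⊟_) (sym ⊟-zero)) })

  -- Multiplication by ∑ⱼ αⱼσʲ and by ∑ⱼ αⱼσ⁻ʲ in ℤ[⟨σ⟩], acting on coefficient functions.
  A A* : (Fin n → ℤ) → Fin n → ℤ
  A  x i = sum (λ j → α j * x (i ⊞ ⊟ j))
  A* x i = sum (λ j → α j * x (i ⊞ j))

  -- `∑1` is n as an integer, kept as a sum so that it can be compared directly with `m`.
  m ∑1 : ℤ
  m = sum α
  ∑1 = sum {n} (λ _ → 1ℤ)

  sum-⊟ : ∀ (x : Fin n → ℤ) → sum (λ i → x (⊟ i)) ≡ sum x
  sum-⊟ x = sym (sum-permute x (permutation ⊟_ ⊟_ ⊟-involutive ⊟-involutive))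

  sum-translate : ∀ (x : Fin n → ℤ) i → sum (λ j → x (i ⊞ j)) ≡ sum x
  sum-translate x i = sym (sum-permute x (permutation (i ⊞_) (⊟ i ⊞_)
    (\\-leftDividesˡ i) (\\-leftDividesʳ i)))

  sum-const : ∀ c → sum {n} (λ _ → c) ≡ ∑1 * c
  sum-const c = begin
    sum {n} (λ _ → c)       ≡⟨ sum-cong-≗ {n} (λ _ → sym (ℤ.*-identityˡ c)) ⟩
    sum {n} (λ _ → 1ℤ * c)  ≡⟨ *-distribʳ-sum {n} c (λ _ → 1ℤ) ⟨
    ∑1 * c                   ∎
    where open ≡-Reasoning

  A+A* : ∀ x i → A x i + A* x i ≡ sum x + x i
  A+A* x i = begin
    A x i + A* x i
      -- Reindexing A* by j ↦ -j makes both sums run over the same values x(i - j), so that only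
      -- α(j) + α(-j) matters.
      ≡⟨ cong (A x i +_) (sum-⊟ (λ j → α j * x (i ⊞ j))) ⟨
    A x i + sum (λ j → α (⊟ j) * y j)
      ≡⟨ ∑-distrib-+ (λ j → α j * y j) (λ j → α (⊟ j) * y j) ⟨
    sum (λ j → α j * y j + α (⊟ j) * y j)
      ≡⟨ sum-cong-≗ (λ j → trans (sym (ℤ.*-distribʳ-+ (y j) (α j) (α (⊟ j)))) (cong (_* y j) (α+α⊟ j))) ⟩
    sum (λ j → (1ℤ + ind j) * y j)
      ≡⟨ sum-cong-≗ (λ j → trans (ℤ.*-distribʳ-+ (y j) 1ℤ (ind j)) (cong (_+ ind j * y j) (ℤ.*-identityˡ (y j)))) ⟩
    sum (λ j → y j + ind j * y j)
      ≡⟨ ∑-distrib-+ y (λ j → ind j * y j) ⟩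
    sum y + sum (λ j → ind j * y j)
      ≡⟨ cong₂ _+_ (trans (sum-⊟ (λ j → x (i ⊞ j))) (sum-translate x i)) (sum-indicator y (0 mod n)) ⟩
    sum x + x (i ⊞ ⊟ (0 mod n))
      ≡⟨ cong (λ k → sum x + x k) (trans (cong (i ⊞_) ⊟-zero) (Z.identityʳ i)) ⟩
    sum x + x i ∎
    where
    open ≡-Reasoning
    y : Fin n → ℤ
    y j = x (i ⊞ ⊟ j)
    ind : Fin n → ℤ
    ind j = if does (j ≟ᶠ 0 mod n) then 1ℤ else 0ℤ

  -- Apply `A+A*` to the constant function 1: both operators give `m`, and the right side is n + 1.
  ∑1≡m+m-1 : ∑1 ≡ m + m + - 1ℤ
  ∑1≡m+m-1 = begin
    ∑1                       ≡⟨ ring ∑1 ⟩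
    ∑1 + 1ℤ + - 1ℤ           ≡⟨ cong (_+ - 1ℤ) (A+A* (λ _ → 1ℤ) (0 mod n)) ⟨
    sum (λ j → α j * 1ℤ) + sum (λ j → α j * 1ℤ) + - 1ℤ
      ≡⟨ cong (λ k → k + k + - 1ℤ) (sum-cong-≗ (λ j → ℤ.*-identityʳ (α j))) ⟩
    m + m + - 1ℤ            ∎
    where
    open ≡-Reasoning
    ring : ∀ a → a ≡ a + 1ℤ + - 1ℤ
    ring = solve-∀

  -- Writing n as 2m - 1 leaves `m` as the only constant, so the identities below become polynomial
  -- ones for the ring solver.
  sum-+-const : ∀ (x : Fin n → ℤ) c → sum (λ i → x i + c) ≡ sum x + (m + m + - 1ℤ) * c
  sum-+-const x c = trans (∑-distrib-+ x (λ _ → c))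
    (cong (sum x +_) (trans (sum-const c) (cong (_* c) ∑1≡m+m-1)))

  sum-α-+ : ∀ (x y : Fin n → ℤ) → sum (λ j → α j * (x j + y j)) ≡ sum (λ j → α j * x j) + sum (λ j → α j * y j)
  sum-α-+ x y = trans (sum-cong-≗ (λ j → ℤ.*-distribˡ-+ (α j) (x j) (y j)))
    (∑-distrib-+ (λ j → α j * x j) (λ j → α j * y j))

  sum-α-+-const : ∀ (x : Fin n → ℤ) c → sum (λ j → α j * (x j + c)) ≡ sum (λ j → α j * x j) + m * c
  sum-α-+-const x c = trans (sum-α-+ x (λ _ → c))
    (cong (sum (λ j → α j * x j) +_) (sym (*-distribʳ-sum c α)))

  sum-⊟-+-const : ∀ (x : Fin n → ℤ) c → sum (λ i → x (⊟ i) + c) ≡ sum x + (m + m + - 1ℤ) * c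
  sum-⊟-+-const x c = trans (sum-+-const (x ∘ ⊟_) c) (cong (_+ (m + m + - 1ℤ) * c) (sum-⊟ x))

  A-cong : ∀ {x y : Fin n → ℤ} → x ≗ y → A x ≗ A y
  A-cong x≗y i = sum-cong-≗ (λ j → cong (α j *_) (x≗y (i ⊞ ⊟ j)))

  A*-cong : ∀ {x y : Fin n → ℤ} → x ≗ y → A* x ≗ A* y
  A*-cong x≗y i = sum-cong-≗ (λ j → cong (α j *_) (x≗y (i ⊞ j)))

  A-translate : ∀ (x : Fin n → ℤ) k i → A (λ j → x (k ⊞ j)) i ≡ A x (k ⊞ i)
  A-translate x k i = sum-cong-≗ (λ j → cong (λ l → α j * x l) (sym (⊞-assoc k i (⊟ j))))

  A*-translate : ∀ (x : Fin n → ℤ) k i → A* (λ j → x (k ⊞ j)) i ≡ A* x (k ⊞ i)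
  A*-translate x k i = sum-cong-≗ (λ j → cong (λ l → α j * x l) (sym (⊞-assoc k i j)))

  -- Because -(i - j) = -i + j, reflection turns backward shifts into forward ones and so exchanges
  -- A with A*. The constant is multiplied by the total weight `m` of α.
  A-⊟ : ∀ (x : Fin n → ℤ) c i → A (λ j → x (⊟ j) + c) i ≡ A* x (⊟ i) + m * c
  A-⊟ x c i = trans (sum-α-+-const (λ j → x (⊟ (i ⊞ ⊟ j))) c)
    (cong (_+ m * c) (sum-cong-≗ (λ j → cong (λ l → α j * x l)
      (trans (sym (⊟-⊞-comm i (⊟ j))) (cong (⊟ i ⊞_) (⊟-involutive j))))))

  A*-⊟ : ∀ (x : Fin n → ℤ) c i → A* (λ j → x (⊟ j) + c) i ≡ A x (⊟ i) + m * c
  A*-⊟ x c i = trans (sum-α-+-const (λ j → x (⊟ (i ⊞ j))) c)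
    (cong (_+ m * c) (sum-cong-≗ (λ j → cong (λ l → α j * x l) (sym (⊟-⊞-comm i j)))))

-- Criteria for an additive map to be an isomorphism and to be equivariant.

module _ (A B : AbelianGroup 0ℓ 0ℓ) where
  private
    module A = AbelianGroup A
    module B = AbelianGroup B
  open Morphism.GroupMorphisms A.rawGroup B.rawGroup using (IsGroupIsomorphism)

  additive-inverse⇒isGroupIsomorphism : ∀ {f : A.Carrier → B.Carrier} {g : B.Carrier → A.Carrier} → IsAdditive A B f →
    (∀ {x y} → x B.≈ y → g x A.≈ g y) → (∀ x → g (f x) A.≈ x) → (∀ y → f (g y) B.≈ y) →
    IsGroupIsomorphism f
  additive-inverse⇒isGroupIsomorphism {f} {g} f-additive g-cong g∘f f∘g = record
    { isGroupMonomorphism = record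
      { isGroupHomomorphism = record
        { isMonoidHomomorphism = record
          { isMagmaHomomorphism = record
            { isRelHomomorphism = record { cong = f-cong }
            ; homo = f-+ }
          ; ε-homo = f-0 }
        ; ⁻¹-homo = f-neg }
      ; injective = λ {x} {y} fx≈fy → A.trans (A.sym (g∘f x)) (A.trans (g-cong fx≈fy) (g∘f y)) }
    ; surjective = λ y → g y , λ x≈gy → B.trans (f-cong x≈gy) (f∘g y)
    }
    where open IsAdditive f-additive

·-additive : {G : Group 0ℓ 0ℓ} (M : GModule G) (g : Group.Carrier G) →
  IsAdditive (GModule.abelianGroup M) (GModule.abelianGroup M) (GModule._·_ M g)
·-additive {G} M g = record { f-cong = ·-cong (Group.refl G) ; f-+ = ·-distrib-+ g }
  where open GModule M

module _ (n : ℕ) .{{_ : NonZero n}} (L M : GModule (D n)) where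
  private
    module D = Group (D n)
    module L = GModule L
    module M = GModule M
  open RawMonoidDefs D.rawMonoid renaming (_×_ to _⋆_) using ()

  -- The group elements with which `f` commutes contain the identity and are closed under products,
  -- and every element has the normal form σⁱτᵇ.
  equivariant-on-σ-τ : ∀ {f} → IsAdditive L.abelianGroup M.abelianGroup f →
    (∀ x → f (σ n L.· x) M.≈ σ n M.· f x) → (∀ x → f (τ n L.· x) M.≈ τ n M.· f x) →
    ∀ g x → f (g L.· x) M.≈ g M.· f x
  equivariant-on-σ-τ {f} f-additive σ-equivariant τ-equivariant (i , b) =
    subst Equivariant (sym (σⁱτᵇ n i b)) (∙-equivariant {toℕ i ⋆ σ n} (power (toℕ i)) (reflection b))
    where
    open IsAdditive f-additive
    Equivariant : D.Carrier → Set
    Equivariant g = ∀ x → f (g L.· x) M.≈ g M.· f x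

    ε-equivariant : Equivariant D.ε
    ε-equivariant x = M.trans (f-cong (L.·-identity x)) (M.sym (M.·-identity (f x)))

    ∙-equivariant : ∀ {g h} → Equivariant g → Equivariant h → Equivariant (g D.∙ h)
    ∙-equivariant {g} {h} p q x = M.trans (f-cong (L.·-assoc g h x)) (M.trans (p (h L.· x))
      (M.trans (M.·-cong refl (q x)) (M.sym (M.·-assoc g h (f x)))))

    power : ∀ k → Equivariant (k ⋆ σ n)
    power ℕ.zero    = ε-equivariant
    power (ℕ.suc k) = ∙-equivariant {σ n} σ-equivariant (power k)

    reflection : ∀ b → Equivariant (if b then τ n else D.ε)
    reflection false = ε-equivariant
    reflection true  = τ-equivariant

-- The actions of σ and τ on the coordinates of M̃₊ and M̃₋.

module Coordinates (n : ℕ) .{{_ : NonZero n}} where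

  open Residues n
  private
    module F = Free (≡.setoid (Basis n)) (Basis-finite n)
  open AbelianGroupProperties ℤ/n using (\\-leftDividesˡ; \\-leftDividesʳ) renaming (⁻¹-involutive to ⊟-involutive)

  coordinate-additive : ∀ b → IsAdditive F.abelianGroup ℤ.+-0-abelianGroup (_⟨$⟩ b)
  coordinate-additive b = record { f-cong = λ p → F.at p b ; f-+ = λ _ _ → refl }

  ∑w-wᵢ : ∀ i → ∑w n ⟨$⟩ wᵢ i ≡ 1ℤ
  ∑w-wᵢ i = begin
    ∑w n ⟨$⟩ wᵢ i
      ≡⟨ IsAdditive.f-sum (coordinate-additive (wᵢ i)) (λ j → F.δ (wᵢ j)) ⟩
    sum (λ j → if does (j ≟ᶠ i) then 1ℤ else 0ℤ)
      ≡⟨ sum-cong-≗ (λ j → ℤ.*-identityʳ (if does (j ≟ᶠ i) then 1ℤ else 0ℤ)) ⟨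
    sum (λ j → (if does (j ≟ᶠ i) then 1ℤ else 0ℤ) * 1ℤ)
      ≡⟨ sum-indicator (λ _ → 1ℤ) i ⟩
    1ℤ ∎
    where open ≡-Reasoning

  ∑w-w : ∑w n ⟨$⟩ w ≡ 0ℤ
  ∑w-w = trans (IsAdditive.f-sum (coordinate-additive w) (λ j → F.δ (wᵢ j))) (sum-replicate-zero n)

  δ-shift : ∀ i j → F.δ (wᵢ (j ⊞ (1 mod n))) ⟨$⟩ wᵢ i ≡ F.δ (wᵢ j) ⟨$⟩ wᵢ (⊟ (1 mod n) ⊞ i)
  δ-shift i j = cong (if_then 1ℤ else 0ℤ) (does-⇔ (mk⇔
    (λ p → trans (sym (\\-leftDividesʳ (1 mod n) j)) (cong (⊟ (1 mod n) ⊞_) (trans (⊞-comm (1 mod n) j) p)))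
    (λ p → trans (⊞-comm j (1 mod n)) (trans (cong ((1 mod n) ⊞_) p) (\\-leftDividesˡ (1 mod n) i))))
    (j ⊞ (1 mod n) ≟ᶠ i) (j ≟ᶠ ⊟ (1 mod n) ⊞ i))

  δ-flip : ∀ i j → F.δ (wᵢ (⊟ j)) ⟨$⟩ wᵢ i ≡ F.δ (wᵢ j) ⟨$⟩ wᵢ (⊟ i)
  δ-flip i j = cong (if_then 1ℤ else 0ℤ) (does-⇔ (mk⇔
    (λ p → trans (sym (⊟-involutive j)) (cong ⊟_ p)) (λ p → trans (cong ⊟_ p) (⊟-involutive i)))
    (⊟ j ≟ᶠ i) (j ≟ᶠ ⊟ i))

  -- Both sides are additive in `x`, so comparing them on basis elements suffices. Since `f` enters
  -- only through its values on the basis, the iterated maps that define the action are never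
  -- unfolded.
  coordinate-of-image : ∀ {f} (φ : Basis n → F.Carrier) → IsAdditive F.abelianGroup F.abelianGroup f → (∀ b → f (F.δ b) F.≈ φ b) →
    ∀ c {h} → IsAdditive F.abelianGroup ℤ.+-0-abelianGroup h → (∀ b → φ b ⟨$⟩ c ≡ h (F.δ b)) →
    ∀ x → f x ⟨$⟩ c ≡ h x
  coordinate-of-image φ f-additive f≈φ c h-additive φ≡h = F.agree-on-basis
    (∘-additive {C = ℤ.+-0-abelianGroup} (coordinate-additive c) f-additive) h-additive
    (λ b → trans (F.at (f≈φ b) c) (φ≡h b))

  module _ {f} (f-additive : IsAdditive F.abelianGroup F.abelianGroup f) where

    module _ (f≈σ : ∀ b → f (F.δ b) F.≈ σ-basis n b) where

      σ-wᵢ : ∀ x i → f x ⟨$⟩ wᵢ i ≡ x ⟨$⟩ wᵢ (⊟ (1 mod n) ⊞ i)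
      σ-wᵢ x i = coordinate-of-image (σ-basis n) f-additive f≈σ (wᵢ i) (coordinate-additive _)
        (λ { (wᵢ j) → δ-shift i j ; w → refl }) x

      σ-w : ∀ x → f x ⟨$⟩ w ≡ x ⟨$⟩ w
      σ-w = coordinate-of-image (σ-basis n) f-additive f≈σ w (coordinate-additive w)
        (λ { (wᵢ j) → refl ; w → refl })

    module _ (f≈τ₊ : ∀ b → f (F.δ b) F.≈ τ₊-basis n b) where

      -- The term `x ⟨$⟩ w` appears at every index because τw contains ∑wᵢ.
      τ₊-wᵢ : ∀ x i → f x ⟨$⟩ wᵢ i ≡ (x ⟨$⟩ wᵢ (⊟ i)) + (x ⟨$⟩ w)
      τ₊-wᵢ x i = coordinate-of-image (τ₊-basis n) f-additive f≈τ₊ (wᵢ i)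
        (record { f-cong = λ p → cong₂ _+_ (F.at p (wᵢ (⊟ i))) (F.at p w)
                ; f-+ = λ a b → ring (a ⟨$⟩ wᵢ (⊟ i)) (b ⟨$⟩ wᵢ (⊟ i)) (a ⟨$⟩ w) (b ⟨$⟩ w) })
        (λ { (wᵢ j) → trans (δ-flip i j) (sym (ℤ.+-identityʳ _)) ; w → trans (ℤ.+-identityˡ _) (∑w-wᵢ i) }) x
        where
        ring : ∀ a b c d → (a + b) + (c + d) ≡ (a + c) + (b + d)
        ring = solve-∀

      τ₊-w : ∀ x → f x ⟨$⟩ w ≡ - (x ⟨$⟩ w)
      τ₊-w = coordinate-of-image (τ₊-basis n) f-additive f≈τ₊ w
        (record { f-cong = λ p → cong -_ (F.at p w) ; f-+ = λ a b → ℤ.neg-distrib-+ (a ⟨$⟩ w) (b ⟨$⟩ w) })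
        (λ { (wᵢ j) → refl ; w → cong (- 1ℤ +_) ∑w-w })

    module _ (f≈τ₋ : ∀ b → f (F.δ b) F.≈ τ₋-basis n b) where

      τ₋-wᵢ : ∀ x i → f x ⟨$⟩ wᵢ i ≡ - (x ⟨$⟩ wᵢ (⊟ i)) + - (x ⟨$⟩ w)
      τ₋-wᵢ x i = coordinate-of-image (τ₋-basis n) f-additive f≈τ₋ (wᵢ i)
        (record { f-cong = λ p → cong₂ (λ a b → - a + - b) (F.at p (wᵢ (⊟ i))) (F.at p w)
                ; f-+ = λ a b → ring (a ⟨$⟩ wᵢ (⊟ i)) (b ⟨$⟩ wᵢ (⊟ i)) (a ⟨$⟩ w) (b ⟨$⟩ w) })
        (λ { (wᵢ j) → trans (cong -_ (δ-flip i j)) (sym (ℤ.+-identityʳ _))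
           ; w → trans (ℤ.+-identityˡ _) (cong -_ (∑w-wᵢ i)) }) x
        where
        ring : ∀ a b c d → - (a + b) + - (c + d) ≡ (- a + - c) + (- b + - d)
        ring = solve-∀

      τ₋-w : ∀ x → f x ⟨$⟩ w ≡ x ⟨$⟩ w
      τ₋-w = coordinate-of-image (τ₋-basis n) f-additive f≈τ₋ w (coordinate-additive w)
        (λ { (wᵢ j) → refl ; w → cong (λ z → 1ℤ + - z) ∑w-w })

-- The map to ℤ[G] ⊕ ℤ[G/⟨σ⟩] in coordinates.

module Isomorphism (n : ℕ) .{{_ : NonZero n}} (n-odd : ¬ (2 ∣ n)) where

  open Residues n
  open OddResidues n n-odd
  open Coordinates n
  private
    module D = Group (D n)
    module L = GLattice (M̃₊ n ⊕ M̃₋ n)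
    module P = GLattice (ℤ[D] n ⊕ ℤ[D/⟨σ⟩] n)
    module M̃₊ = GLattice (M̃₊ n)
    module M̃₋ = GLattice (M̃₋ n)
    module F = Free (≡.setoid (Basis n)) (Basis-finite n)
    module FD = Free D.setoid (D-finite n)
    module FC = Free (GSet.setoid (D/⟨σ⟩ n)) (D/⟨σ⟩-finite n)
  open AbelianGroupProperties ℤ/n using () renaming (⁻¹-involutive to ⊟-involutive)

  fromCoordinates : (Fin n → ℤ) → ℤ → F.Carrier
  fromCoordinates x c = record { to = λ { (wᵢ i) → x i ; w → c } ; cong = cong _ }

  onD : (Fin n → Bool → ℤ) → FD.Carrier
  onD u = record { to = λ { (i , b) → u i b } ; cong = cong _ }

  -- Members of ⟨σ⟩ have second component `false`, so a function of that component is well defined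
  -- on cosets.
  coset-≡ : ∀ {g h} → Subgroup.Member (⟨σ⟩ n) (g D.⁻¹ D.∙ h) → proj₂ g ≡ proj₂ h
  coset-≡ {_ , false} {_ , false} _ = refl
  coset-≡ {_ , true}  {_ , true}  _ = refl
  coset-≡ {_ , false} {_ , true}  p = contradiction (⟨σ⟩⇒ n p) λ ()
  coset-≡ {_ , true}  {_ , false} p = contradiction (⟨σ⟩⇒ n p) λ ()

  onCosets : (Bool → ℤ) → FC.Carrier
  onCosets r = record { to = λ g → r (proj₂ g) ; cong = λ {g} {h} p → cong r (coset-≡ {g} {h} p) }

  coset-coefficient : (c : FC.Carrier) → ∀ i b → c ⟨$⟩ (i , b) ≡ c ⟨$⟩ (0 mod n , b)
  coset-coefficient c i b = Func.cong c (⇒⟨σ⟩ n _ (xor-same b))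

  -- Here (`x`, `c`) are the coefficients in M̃₊ and (`y`, `d`) those in M̃₋; `false` selects the
  -- coefficient on σⁱ and `true` the one on σⁱτ.
  to-D : (x : Fin n → ℤ) (c : ℤ) (y : Fin n → ℤ) (d : ℤ) → Fin n → Bool → ℤ
  to-D x c y d i false = A x i + (y i + (m * c + d))
  to-D x c y d i true  = A* x i + - y i

  -- The coefficients of e and f in the image of `w`. They add up to n, so subtracting each from n,
  -- as τw = -w + ∑wᵢ demands, swaps them.
  p : Bool → ℤ
  p false = m
  p true  = m + - 1ℤ

  to-C : (x : Fin n → ℤ) (c d : ℤ) → Bool → ℤ
  to-C x c d b = sum x + (p b * c + d)

  to : L.Carrier → P.Carrier
  to (a , b) =
      onD (to-D (λ i → a ⟨$⟩ wᵢ i) (a ⟨$⟩ w) (λ i → b ⟨$⟩ wᵢ i) (b ⟨$⟩ w))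
    , onCosets (to-C (λ i → a ⟨$⟩ wᵢ i) (a ⟨$⟩ w) (b ⟨$⟩ w))

  to-D-cong : ∀ {x x′ c c′ y y′ d d′} → x ≗ x′ → c ≡ c′ → y ≗ y′ → d ≡ d′ →
    ∀ i b → to-D x c y d i b ≡ to-D x′ c′ y′ d′ i b
  to-D-cong p refl q refl i false = cong₂ (λ s t → s + (t + _)) (A-cong p i) (q i)
  to-D-cong p refl q refl i true  = cong₂ (λ s t → s + - t) (A*-cong p i) (q i)

  to-C-cong : ∀ {x x′ c c′ d d′} → x ≗ x′ → c ≡ c′ → d ≡ d′ → ∀ b → to-C x c d b ≡ to-C x′ c′ d′ b
  to-C-cong x≗x′ refl refl b = cong (_+ _) (sum-cong-≗ x≗x′)

  to-D-+ : ∀ x c y d x′ c′ y′ d′ i b →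
    to-D (λ j → x j + x′ j) (c + c′) (λ j → y j + y′ j) (d + d′) i b ≡ to-D x c y d i b + to-D x′ c′ y′ d′ i b
  to-D-+ x c y d x′ c′ y′ d′ i false = trans
    (cong (_+ _) (sum-α-+ (λ j → x (i ⊞ ⊟ j)) (λ j → x′ (i ⊞ ⊟ j))))
    (ring (A x i) (A x′ i) (y i) (y′ i) m c c′ d d′)
    where
    ring : ∀ a a′ y y′ m c c′ d d′ → (a + a′) + ((y + y′) + (m * (c + c′) + (d + d′))) ≡
      (a + (y + (m * c + d))) + (a′ + (y′ + (m * c′ + d′)))
    ring = solve-∀
  to-D-+ x c y d x′ c′ y′ d′ i true  = trans
    (cong (_+ _) (sum-α-+ (λ j → x (i ⊞ j)) (λ j → x′ (i ⊞ j))))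
    (ring (A* x i) (A* x′ i) (y i) (y′ i))
    where
    ring : ∀ a a′ y y′ → (a + a′) + - (y + y′) ≡ (a + - y) + (a′ + - y′)
    ring = solve-∀

  to-C-+ : ∀ x c d x′ c′ d′ b → to-C (λ j → x j + x′ j) (c + c′) (d + d′) b ≡ to-C x c d b + to-C x′ c′ d′ b
  to-C-+ x c d x′ c′ d′ b = trans
    (cong (_+ (p b * (c + c′) + (d + d′))) (∑-distrib-+ x x′))
    (ring (sum x) (sum x′) (p b) c c′ d d′)
    where
    ring : ∀ s s′ k c c′ d d′ → (s + s′) + (k * (c + c′) + (d + d′)) ≡ (s + (k * c + d)) + (s′ + (k * c′ + d′))
    ring = solve-∀

  to-additive : IsAdditive L.abelianGroup P.abelianGroup to
  to-additive = record
    { f-cong = λ { (a≈ , b≈) →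
          FD.pointwise (λ { (i , b) → to-D-cong (F.at a≈ ∘ wᵢ) (F.at a≈ w) (F.at b≈ ∘ wᵢ) (F.at b≈ w) i b })
        , FC.pointwise (λ { (i , b) → to-C-cong (F.at a≈ ∘ wᵢ) (F.at a≈ w) (F.at b≈ w) b }) }
    ; f-+ = λ _ _ → FD.pointwise (λ { (i , b) → to-D-+ _ _ _ _ _ _ _ _ i b })
                  , FC.pointwise (λ { (i , b) → to-C-+ _ _ _ _ _ _ b })
    }

  -- Equivariance under σ and τ.

  to-D-translate : ∀ x c y d k i b → to-D (λ j → x (k ⊞ j)) c (λ j → y (k ⊞ j)) d i b ≡ to-D x c y d (k ⊞ i) b
  to-D-translate x c y d k i false = cong (_+ _) (A-translate x k i)
  to-D-translate x c y d k i true  = cong (_+ _) (A*-translate x k i)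

  to-C-translate : ∀ x c d k b → to-C (λ j → x (k ⊞ j)) c d b ≡ to-C x c d b
  to-C-translate x c d k b = cong (_+ (p b * c + d)) (sum-translate x k)

  -- A and A* trade places, and the shift of `x` by `c` contributes `m * c` in both cases. On σⁱ
  -- this cancels `m * - c`, coming from -w; on σⁱτ it supplies the term that the image of `w` has
  -- on σⁱ. The shift by `- d` plays the same role for w′.
  to-D-reflect : ∀ x c y d i b →
    to-D (λ j → x (⊟ j) + c) (- c) (λ j → - y (⊟ j) + - d) d i b ≡ to-D x c y d (⊟ i) (not b)
  to-D-reflect x c y d i false = trans (cong (_+ _) (A-⊟ x c i)) (ring (A* x (⊟ i)) m c (y (⊟ i)) d)
    where
    ring : ∀ a m c y d → (a + m * c) + ((- y + - d) + (m * - c + d)) ≡ a + - y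
    ring = solve-∀
  to-D-reflect x c y d i true  = trans (cong (_+ _) (A*-⊟ x c i)) (ring (A x (⊟ i)) m c (y (⊟ i)) d)
    where
    ring : ∀ a m c y d → (a + m * c) + - (- y + - d) ≡ a + (y + (m * c + d))
    ring = solve-∀

  -- Shifting `x` by `c` adds (2m - 1)c to its sum, and subtracting m or m - 1 from 2m - 1 gives the
  -- other.
  to-C-reflect : ∀ x c d b → to-C (λ j → x (⊟ j) + c) (- c) d b ≡ to-C x c d (not b)
  to-C-reflect x c d false = trans (cong (_+ _) (sum-⊟-+-const x c)) (ring (sum x) m c d)
    where
    ring : ∀ s m c d → (s + (m + m + - 1ℤ) * c) + (m * - c + d) ≡ s + ((m + - 1ℤ) * c + d)
    ring = solve-∀
  to-C-reflect x c d true = trans (cong (_+ _) (sum-⊟-+-const x c)) (ring (sum x) m c d)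
    where
    ring : ∀ s m c d → (s + (m + m + - 1ℤ) * c) + ((m + - 1ℤ) * - c + d) ≡ s + (m * c + d)
    ring = solve-∀

  σ-equivariant : ∀ z → to (σ n L.· z) P.≈ σ n P.· to z
  σ-equivariant (a , b) =
      FD.pointwise (λ { (i , e) → trans
        (to-D-cong (σ-wᵢ a-σ (M̃₊-σ n) a) (σ-w a-σ (M̃₊-σ n) a) (σ-wᵢ b-σ (M̃₋-σ n) b) (σ-w b-σ (M̃₋-σ n) b) i e)
        (to-D-translate (λ j → a ⟨$⟩ wᵢ j) (a ⟨$⟩ w) (λ j → b ⟨$⟩ wᵢ j) (b ⟨$⟩ w) (⊟ (1 mod n)) i e) })
    , FC.pointwise (λ { (i , e) → trans
        (to-C-cong (σ-wᵢ a-σ (M̃₊-σ n) a) (σ-w a-σ (M̃₊-σ n) a) (σ-w b-σ (M̃₋-σ n) b) e)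
        (to-C-translate (λ j → a ⟨$⟩ wᵢ j) (a ⟨$⟩ w) (b ⟨$⟩ w) (⊟ (1 mod n)) e) })
    where
    a-σ = ·-additive M̃₊.gModule (σ n)
    b-σ = ·-additive M̃₋.gModule (σ n)

  τ-equivariant : ∀ z → to (τ n L.· z) P.≈ τ n P.· to z
  τ-equivariant (a , b) =
      FD.pointwise (λ { (i , e) → trans
        (to-D-cong (τ₊-wᵢ a-τ (M̃₊-τ n) a) (τ₊-w a-τ (M̃₊-τ n) a) (τ₋-wᵢ b-τ (M̃₋-τ n) b) (τ₋-w b-τ (M̃₋-τ n) b) i e)
        (trans (to-D-reflect x c y d i e) (cong (λ j → to-D x c y d j (not e)) (sym (0-⊟ i)))) })
    , FC.pointwise (λ { (i , e) → trans
        (to-C-cong (τ₊-wᵢ a-τ (M̃₊-τ n) a) (τ₊-w a-τ (M̃₊-τ n) a) (τ₋-w b-τ (M̃₋-τ n) b) e)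
        (to-C-reflect x c d e) })
    where
    a-τ = ·-additive M̃₊.gModule (τ n)
    b-τ = ·-additive M̃₋.gModule (τ n)
    x y : Fin n → ℤ
    x j = a ⟨$⟩ wᵢ j
    y j = b ⟨$⟩ wᵢ j
    c d : ℤ
    c = a ⟨$⟩ w
    d = b ⟨$⟩ w
    -- The permutation action evaluates at τ⁻¹(i , e), and the first component of τ⁻¹ computes to
    -- -(-0).
    0-⊟ : ∀ i → (⊟ (⊟ (0 mod n))) ⊞ (⊟ i) ≡ ⊟ i
    0-⊟ i = trans (cong (_⊞ (⊟ i)) (⊟-involutive (0 mod n))) (⊞-identityˡ (⊟ i))

  -- The inverse map and its verification.

  module Inverse (u : Fin n → Bool → ℤ) (r : Bool → ℤ) where

    -- These solve the equations of `to` in turn. Adding the coefficients on σⁱ and σⁱτ eliminates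
    -- y, and A + A* = 1 + N leaves x plus the coefficient on e. The difference of the coset
    -- coefficients is c, as m - (m - 1) = 1. Finally, y is read off on σⁱ.
    x y : Fin n → ℤ
    c d : ℤ
    x i = u i false + u i true + - r false
    c   = r false + - r true
    y i = u i false + - A x i + - (m * c + d)
    d   = m * (r false + r true) + - sum (λ i → u i false + u i true)

    -- Once n is replaced by 2m - 1, this is a polynomial identity in m, the two values of `r` and
    -- ∑(u + v). The case `false` is used again in `to-D-inverse`.
    to-C-inverse : ∀ b → to-C x c d b ≡ r b
    to-C-inverse b = trans
      (cong (_+ (p b * c + d)) (sum-+-const (λ i → u i false + u i true) (- r false))) (coefficient b)
      where
      ring-false : ∀ s m r r′ → s + (m + m + - 1ℤ) * - r + (m * (r + - r′) + (m * (r + r′) + - s)) ≡ r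
      ring-false = solve-∀
      ring-true : ∀ s m r r′ → s + (m + m + - 1ℤ) * - r + ((m + - 1ℤ) * (r + - r′) + (m * (r + r′) + - s)) ≡ r′
      ring-true = solve-∀
      s : ℤ
      s = sum (λ i → u i false + u i true)
      coefficient : ∀ b → s + (m + m + - 1ℤ) * - r false + (p b * c + d) ≡ r b
      coefficient false = ring-false s m (r false) (r true)
      coefficient true  = ring-true s m (r false) (r true)

    to-D-inverse : ∀ i b → to-D x c y d i b ≡ u i b
    to-D-inverse i false = ring (A x i) (u i false) (m * c + d)
      where
      ring : ∀ a u k → a + (u + - a + - k + k) ≡ u
      ring = solve-∀
    to-D-inverse i true  = begin
      A* x i + - (u i false + - A x i + - (m * c + d)) ≡⟨ ring (A x i) (A* x i) (u i false) (m * c + d) ⟩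
      A x i + A* x i + (m * c + d) + - u i false       ≡⟨ cong (λ s → s + (m * c + d) + - u i false) (A+A* x i) ⟩
      -- Regrouping exhibits `sum x + (m * c + d)`, the coefficient on e, which is already known to
      -- be `r false`.
      sum x + x i + (m * c + d) + - u i false          ≡⟨ ring′ (sum x) (x i) (m * c + d) (u i false) ⟩
      x i + to-C x c d false + - u i false             ≡⟨ cong (λ s → x i + s + - u i false) (to-C-inverse false) ⟩
      x i + r false + - u i false                      ≡⟨ ring″ (u i false) (u i true) (r false) ⟩
      u i true                                         ∎
      where
      open ≡-Reasoning
      ring : ∀ a a* u k → a* + - (u + - a + - k) ≡ a + a* + k + - u
      ring = solve-∀
      ring′ : ∀ s x k u → s + x + k + - u ≡ x + (s + k) + - u
      ring′ = solve-∀
      ring″ : ∀ u v r → u + v + - r + r + - u ≡ v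
      ring″ = solve-∀

  from : P.Carrier → L.Carrier
  from (a , b) = fromCoordinates x c , fromCoordinates y d
    where open Inverse (λ i e → a ⟨$⟩ (i , e)) (λ e → b ⟨$⟩ (0 mod n , e))

  module _ (x : Fin n → ℤ) (c : ℤ) (y : Fin n → ℤ) (d : ℤ) where
    private module I = Inverse (to-D x c y d) (to-C x c d)

    inverse-x : I.x ≗ x
    inverse-x i = begin
      A x i + (y i + (m * c + d)) + (A* x i + - y i) + - (sum x + (m * c + d)) ≡⟨ ring (A x i) (A* x i) (y i) (m * c + d) (sum x) ⟩
      A x i + A* x i + - sum x                                                 ≡⟨ cong (_+ - sum x) (A+A* x i) ⟩
      sum x + x i + - sum x                                                    ≡⟨ ring′ (sum x) (x i) ⟩
      x i                                                                      ∎
      where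
      open ≡-Reasoning
      ring : ∀ a a* y k s → a + (y + k) + (a* + - y) + - (s + k) ≡ a + a* + - s
      ring = solve-∀
      ring′ : ∀ s x → s + x + - s ≡ x
      ring′ = solve-∀

    inverse-c : I.c ≡ c
    inverse-c = ring (sum x) m c d
      where
      ring : ∀ s m c d → s + (m * c + d) + - (s + ((m + - 1ℤ) * c + d)) ≡ c
      ring = solve-∀

    -- By `inverse-x`, u + v = x + r pointwise, so ∑(u + v) = ∑x + (2m - 1)r. In m(r + r′) minus
    -- this, d survives with coefficient 2m - (2m - 1) = 1 and everything else cancels.
    inverse-d : I.d ≡ d
    inverse-d = begin
      m * (r + r′) + - sum (λ i → u i false + u i true)     ≡⟨ cong (λ s → m * (r + r′) + - s) (sum-cong-≗ u+u) ⟩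
      m * (r + r′) + - sum (λ i → x i + r)                  ≡⟨ cong (λ s → m * (r + r′) + - s) (sum-+-const x r) ⟩
      m * (r + r′) + - (sum x + (m + m + - 1ℤ) * r)         ≡⟨ ring (sum x) m c d ⟩
      d                                                     ∎
      where
      open ≡-Reasoning
      u : Fin n → Bool → ℤ
      u = to-D x c y d
      r r′ : ℤ
      r  = to-C x c d false
      r′ = to-C x c d true
      ring₀ : ∀ u r → u ≡ u + - r + r
      ring₀ = solve-∀
      u+u : ∀ i → u i false + u i true ≡ x i + r
      u+u i = trans (ring₀ (u i false + u i true) r) (cong (_+ r) (inverse-x i))
      ring : ∀ s m c d →
        m * ((s + (m * c + d)) + (s + ((m + - 1ℤ) * c + d))) + - (s + (m + m + - 1ℤ) * (s + (m * c + d))) ≡ d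
      ring = solve-∀

    inverse-y : I.y ≗ y
    inverse-y i = begin
      A x i + (y i + (m * c + d)) + - A I.x i + - (m * I.c + I.d)
        ≡⟨ cong₂ (λ a k → A x i + (y i + (m * c + d)) + - a + - k)
             (A-cong inverse-x i) (cong₂ (λ c d → m * c + d) inverse-c inverse-d) ⟩
      A x i + (y i + (m * c + d)) + - A x i + - (m * c + d)
        ≡⟨ ring (A x i) (y i) (m * c + d) ⟩
      y i ∎
      where
      open ≡-Reasoning
      ring : ∀ a y k → a + (y + k) + - a + - k ≡ y
      ring = solve-∀

  from∘to : ∀ z → from (to z) L.≈ z
  from∘to (a , b) =
      F.pointwise (λ { (wᵢ i) → inverse-x x c y d i ; w → inverse-c x c y d })
    , F.pointwise (λ { (wᵢ i) → inverse-y x c y d i ; w → inverse-d x c y d })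
    where
    x y : Fin n → ℤ
    x i = a ⟨$⟩ wᵢ i
    y i = b ⟨$⟩ wᵢ i
    c d : ℤ
    c = a ⟨$⟩ w
    d = b ⟨$⟩ w

  to∘from : ∀ z → to (from z) P.≈ z
  to∘from (a , b) =
      FD.pointwise (λ { (i , e) → to-D-inverse i e })
    -- `from` samples `b` only at the representatives (0 , e); constancy on cosets recovers the
    -- other values.
    , FC.pointwise (λ { (i , e) → trans (to-C-inverse e) (sym (coset-coefficient b i e)) })
    where open Inverse (λ i e → a ⟨$⟩ (i , e)) (λ e → b ⟨$⟩ (0 mod n , e))

  from-cong : ∀ {z z′} → z P.≈ z′ → from z L.≈ from z′
  from-cong {a , b} {a′ , b′} (a≈ , b≈) =
      F.pointwise (λ { (wᵢ i) → x-cong i ; w → c-cong })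
    , F.pointwise (λ { (wᵢ i) → cong₂ _+_ (cong₂ (λ u s → u + - s) (u-cong i false) (A-cong x-cong i))
                                          (cong₂ (λ c d → - (m * c + d)) c-cong d-cong)
                     ; w → d-cong })
    where
    module I  = Inverse (λ i e → a ⟨$⟩ (i , e)) (λ e → b ⟨$⟩ (0 mod n , e))
    module I′ = Inverse (λ i e → a′ ⟨$⟩ (i , e)) (λ e → b′ ⟨$⟩ (0 mod n , e))
    u-cong : ∀ i e → a ⟨$⟩ (i , e) ≡ a′ ⟨$⟩ (i , e)
    u-cong i e = FD.at a≈ (i , e)
    r-cong : ∀ e → b ⟨$⟩ (0 mod n , e) ≡ b′ ⟨$⟩ (0 mod n , e)
    r-cong e = FC.at b≈ (0 mod n , e)
    x-cong : I.x ≗ I′.x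
    x-cong i = cong₂ _+_ (cong₂ _+_ (u-cong i false) (u-cong i true)) (cong -_ (r-cong false))
    c-cong : I.c ≡ I′.c
    c-cong = cong₂ (λ r s → r + - s) (r-cong false) (r-cong true)
    d-cong : I.d ≡ I′.d
    d-cong = cong₂ (λ r s → r + - s)
      (cong (m *_) (cong₂ _+_ (r-cong false) (r-cong true)))
      (sum-cong-≗ (λ i → cong₂ _+_ (u-cong i false) (u-cong i true)))

theorem3p7 : (n : ℕ) .{{_ : NonZero n}} → 3 ≤ n → ¬ (2 ∣ n) →
    (M̃₊ n ⊕ M̃₋ n) ≅ (ℤ[D] n ⊕ ℤ[D/⟨σ⟩] n)
theorem3p7 n _ n-odd = record
  { ⟦_⟧                = to
  ; isGroupIsomorphism = additive-inverse⇒isGroupIsomorphism L.abelianGroup P.abelianGroup {f = to} {g = from}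
      to-additive (λ {z} {z′} → from-cong {z} {z′}) from∘to to∘from
  ; equivariant        = equivariant-on-σ-τ n L.gModule P.gModule {f = to}
      to-additive σ-equivariant τ-equivariant
  }
  where
  open Isomorphism n n-odd
  module L = GLattice (M̃₊ n ⊕ M̃₋ n)
  module P = GLattice (ℤ[D] n ⊕ ℤ[D/⟨σ⟩] n)
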